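{- Let $\mathcal M\models T$, $k\in\mathbb N$ and $a\in M^k$. The function $d_{\mathcal G}:\mathcal G\times\mathcal G\to\mathcal K$ on the set $\mathcal G=\mathcal G_a$ of germs of $\mathcal L$-definable curves in $M^k$ at $a$ is a well-defined $\mathcal K$-metric on $\mathcal G$ (that is, independent of representatives, zero exactly on the diagonal, symmetric, and satisfying the triangle inequality in the ordered field $\mathcal K$).
   Context: $T$ is a complete o-minimal theory expanding the theory of real closed ordered fields in a language $\mathcal L$, with quantifier elimination and universally axiomatizable; definable means definable with parameters. $\mathcal K=\mathcal H_{0^+}$ is the Hardy field of germs at $0^+$ of $\mathcal L(M)$-definable unary functions: two such functions have the same germ if they agree on some interval $(0,c)$ with $c>0$, and $\mathcal K$ is an ordered field under the operations and order induced from representatives. The germ of $f$ is written $[f]_{\mathcal K}$. $d(x,y)=\max_{i=1}^k|x_i-y_i|$ is the sup metric on $M^k$, and $B(a,\varepsilon)$ is the corresponding ball. A curve at $a$ is a continuous function $\gamma:(0,1)\to M^k$ with $\lim_{t\to0}\gamma(t)=a$. For two curves $\gamma,\sigma$ at $a$, write $\gamma\sim\sigma$ if there is $\varepsilon>0$ with $B(a,\varepsilon)\cap\gamma((0,1))=B(a,\varepsilon)\cap\sigma((0,1))$. The class of $\gamma$ is denoted $[\gamma]$, and $\mathcal G_a$ is the set of classes (germs) of $\mathcal L$-definable curves in $M^k$ at $a$. The function $d_{\mathcal G}$ is defined by $d_{\mathcal G}([\gamma],[\sigma])=[f]_{\mathcal K}$, where, for all sufficiently small $t>0$, $$f(t)=D\bigl(B(a,t)\cap\gamma((0,1)),\,B(a,t)\cap\sigma((0,1))\bigr)$$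 and $D$ is the Hausdorff distance induced by $d$.
   Formalization: Two curves count as the same germ if their images, with the base point a adjoined to both, agree on some ball around a; under the literal ∼ the claim fails (k=1, a=0, curves t and t(1−2t)² have distance 0 but are not equivalent). -}

module Defs where

open import Algebra.Core using (Op₁; Op₂)
open import Algebra.Structures using (IsCommutativeRing)
import Algebra.Construct.NaturalChoice.Max as Max
open import Data.Empty using (⊥; ⊥-elim)
open import Data.Fin.Base using (Fin; zero; suc; _↑ˡ_; _↑ʳ_; splitAt)
open import Data.Fin.Patterns using (0F; 1F; 2F; 3F)
open import Data.Fin.Properties using (join-splitAt)
open import Data.List.Base using (List; []; _∷_)
open import Data.List.Relation.Unary.Any using (Any; here; there)
open import Data.Nat.Base using (ℕ; zero; suc)
import Data.Nat.Base as ℕ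
open import Data.Product.Base using (Σ-syntax; ∃-syntax; _×_; _,_; proj₁; proj₂; map₂)
open import Data.Sum.Base using (_⊎_; inj₁; inj₂; [_,_]′)
open import Data.Vec.Base using (Vec; []; _∷_; lookup; tabulate; foldr′; zipWith; _++_; _∷ʳ_)
open import Data.Vec.Properties
  using (lookup-++ˡ; lookup-++ʳ; lookup∘tabulate)
open import Function.Base using (_∘_; id; case_of_)
open import Function.Bundles using (_⇔_; mk⇔; Equivalence)
open import Function.Metric.Structures using (IsGeneralMetric)
open import Function.Construct.Composition using (_⇔-∘_)
open import Function.Construct.Identity using (⇔-id)
open import Level using (0ℓ)
open import Relation.Binary.Bundles using (Setoid; TotalOrder)
open import Relation.Binary.Core using (Rel)
open import Relation.Binary.Definitions using (Trichotomous; tri<; tri≈; tri>)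
open import Relation.Binary.Structures
  using (IsEquivalence; IsStrictTotalOrder)
import Relation.Binary.Construct.Add.Extrema.Strict as ExtremaStrict
import Relation.Binary.Construct.Add.Supremum.Strict as SupremumStrict
import Relation.Binary.Construct.StrictToNonStrict as StrictToNonStrict
open import Relation.Binary.PropositionalEquality
  using (_≡_; _≢_; refl; sym; trans; cong; cong₂; subst; subst₂)
open import Relation.Nullary.Construct.Add.Extrema using (_±; ⊥±; ⊤±; [_])
open import Relation.Nullary.Negation using (¬_)
open import Relation.Unary using (Pred; _∈_; _∩_; _∪_; ｛_｝; _≐_)

open Equivalence using (to; from)

record Language : Set₁ where
  field
    Func : ℕ → Set
    Rels : ℕ → Set

module _ (L : Language) where
  open Language L

  data Term (n : ℕ) : Set where
    var : Fin n → Term n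
    app : ∀ {m} → Func m → Vec (Term n) m → Term n

  infix  7 _≐̇_
  infixr 6 _∧̇_
  infixr 5 _∨̇_
  infixr 4 _⇒̇_

  -- Variables are de Bruijn indices; a quantifier binds index zero.
  data Formula (n : ℕ) : Set where
    ⊥̇    : Formula n
    _≐̇_  : Term n → Term n → Formula n
    rel  : ∀ {m} → Rels m → Vec (Term n) m → Formula n
    _∧̇_  : Formula n → Formula n → Formula n
    _∨̇_  : Formula n → Formula n → Formula n
    _⇒̇_  : Formula n → Formula n → Formula n
    ∀̇_   : Formula (suc n) → Formula n
    ∃̇_   : Formula (suc n) → Formula n

  Sentence : Set
  Sentence = Formula 0

  Theory : Set₁
  Theory = Sentence → Set

  record Structure : Set₁ where
    field
      Carrier : Set
      func    : ∀ {m} → Func m → Vec Carrier m → Carrier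
      rels    : ∀ {m} → Rels m → Vec Carrier m → Set

module _ {L : Language} where
  open Language L

  infix 8 ¬̇_
  ¬̇_ : ∀ {n} → Formula L n → Formula L n
  ¬̇ φ = φ ⇒̇ ⊥̇

  data QuantifierFree {n : ℕ} : Formula L n → Set where
    ⊥̇   : QuantifierFree ⊥̇
    _≐̇_ : ∀ s t → QuantifierFree (s ≐̇ t)
    rel : ∀ {m} (R : Rels m) ts → QuantifierFree (rel R ts)
    _∧̇_ : ∀ {φ ψ} → QuantifierFree φ → QuantifierFree ψ → QuantifierFree (φ ∧̇ ψ)
    _∨̇_ : ∀ {φ ψ} → QuantifierFree φ → QuantifierFree ψ → QuantifierFree (φ ∨̇ ψ)
    _⇒̇_ : ∀ {φ ψ} → QuantifierFree φ → QuantifierFree ψ → QuantifierFree (φ ⇒̇ ψ)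

  data Universal {n : ℕ} : Formula L n → Set where
    qf : ∀ {φ} → QuantifierFree φ → Universal φ
    ∀̇_ : ∀ {φ} → Universal φ → Universal (∀̇ φ)

module Semantics {L : Language} (𝔐 : Structure L) where
  open Language L
  open Structure 𝔐

  mutual
    ⟦_⟧ : ∀ {n} → Term L n → Vec Carrier n → Carrier
    ⟦ var i ⟧    ρ = lookup ρ i
    ⟦ app f ts ⟧ ρ = func f (⟦ ts ⟧* ρ)

    ⟦_⟧* : ∀ {n m} → Vec (Term L n) m → Vec Carrier n → Vec Carrier m
    ⟦ [] ⟧*     ρ = []
    ⟦ t ∷ ts ⟧* ρ = ⟦ t ⟧ ρ ∷ ⟦ ts ⟧* ρ

  infix 3 _⊨_
  _⊨_ : ∀ {n} → Vec Carrier n → Formula L n → Set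
  ρ ⊨ ⊥̇        = ⊥
  ρ ⊨ s ≐̇ t    = ⟦ s ⟧ ρ ≡ ⟦ t ⟧ ρ
  ρ ⊨ rel R ts = rels R (⟦ ts ⟧* ρ)
  ρ ⊨ φ ∧̇ ψ    = (ρ ⊨ φ) × (ρ ⊨ ψ)
  ρ ⊨ φ ∨̇ ψ    = (ρ ⊨ φ) ⊎ (ρ ⊨ ψ)
  ρ ⊨ φ ⇒̇ ψ    = (ρ ⊨ φ) → (ρ ⊨ ψ)
  ρ ⊨ ∀̇ φ      = ∀ x → x ∷ ρ ⊨ φ
  ρ ⊨ ∃̇ φ      = ∃[ x ] (x ∷ ρ ⊨ φ)

  -- Definable with parameters.
  Definable : ∀ {n} → Pred (Vec Carrier n) 0ℓ → Set
  Definable {n} X =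
    Σ[ m ∈ ℕ ] Σ[ φ ∈ Formula L (n ℕ.+ m) ] Σ[ b ∈ Vec Carrier m ]
      (∀ x → x ∈ X ⇔ (x ++ b ⊨ φ))

infix 3 _⊨ᵀ_ _⊫_

_⊨ᵀ_ : {L : Language} → Structure L → Theory L → Set
𝔐 ⊨ᵀ T = ∀ φ → T φ → [] ⊨ φ
  where open Semantics 𝔐

_⊫_ : {L : Language} {n : ℕ} → Theory L → Formula L n → Set₁
_⊫_ {L} T φ = (𝔐 : Structure L) → 𝔐 ⊨ᵀ T → let open Semantics 𝔐 in ∀ ρ → ρ ⊨ φ

module _ {L : Language} (T : Theory L) where

  IsComplete : Set₁
  IsComplete = (φ : Sentence L) → (T ⊫ φ) ⊎ (T ⊫ ¬̇ φ)

  HasQuantifierElimination : Set₁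
  HasQuantifierElimination =
    ∀ {n} (φ : Formula L n) → Σ[ ψ ∈ Formula L n ]
      QuantifierFree ψ × (T ⊫ (φ ⇒̇ ψ) ∧̇ (ψ ⇒̇ φ))

  IsUniversallyAxiomatizable : Set₁
  IsUniversallyAxiomatizable =
    Σ[ U ∈ Theory L ] (∀ φ → U φ → Universal φ) ×
      ((𝔐 : Structure L) → (𝔐 ⊨ᵀ T) ⇔ (𝔐 ⊨ᵀ U))

record IsOrderedField {A : Set} (_≈_ _<_ : Rel A 0ℓ)
                      (_+_ _*_ : Op₂ A) (-_ : Op₁ A) (0# 1# : A) : Set where
  field
    isCommutativeRing  : IsCommutativeRing _≈_ _+_ _*_ -_ 0# 1#
    isStrictTotalOrder : IsStrictTotalOrder _≈_ _<_
    0<1                : 0# < 1#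
    invertible         : ∀ x → ¬ (x ≈ 0#) → ∃[ y ] ((x * y) ≈ 1#)
    +-monoˡ-<          : ∀ {x y} z → x < y → (x + z) < (y + z)
    *-pos              : ∀ {x y} → 0# < x → 0# < y → 0# < (x * y)

record OrderedField : Set₁ where
  infix  8 -_
  infixl 7 _*_
  infixl 6 _+_
  infix  4 _≈_ _<_
  field
    Carrier        : Set
    _≈_ _<_        : Rel Carrier 0ℓ
    _+_ _*_        : Op₂ Carrier
    -_             : Op₁ Carrier
    0# 1#          : Carrier
    isOrderedField : IsOrderedField _≈_ _<_ _+_ _*_ -_ 0# 1#

  open IsOrderedField isOrderedField public
  open StrictToNonStrict _≈_ _<_ public using (_≤_)

  totalOrder : TotalOrder 0ℓ 0ℓ 0ℓ
  totalOrder = record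
    { isTotalOrder = StrictToNonStrict.isTotalOrder _≈_ _<_ isStrictTotalOrder }

  open Max totalOrder public using (_⊔_)

  ∣_∣ : Carrier → Carrier
  ∣ x ∣ = x ⊔ (- x)

record OrderedRingSymbols (L : Language) : Set where
  open Language L
  field
    zeroˢ oneˢ  : Func 0
    plusˢ multˢ : Func 2
    negˢ        : Func 1
    lessˢ       : Rels 2

module OrderedRingReduct {L : Language} (S : OrderedRingSymbols L) (𝔐 : Structure L) where
  open OrderedRingSymbols S
  open Structure 𝔐 public

  infix  8 -_
  infixl 7 _*_
  infixl 6 _+_
  infix  4 _<_

  0# 1# : Carrier
  0# = func zeroˢ []
  1# = func oneˢ []

  _+_ _*_ : Op₂ Carrier
  x + y = func plusˢ (x ∷ y ∷ [])
  x * y = func multˢ (x ∷ y ∷ [])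

  -_ : Op₁ Carrier
  - x = func negˢ (x ∷ [])

  _<_ : Rel Carrier 0ℓ
  x < y = rels lessˢ (x ∷ y ∷ [])

  -- Coefficients are listed in order of increasing degree.
  evalPoly : ∀ {n} → Vec Carrier n → Carrier → Carrier
  evalPoly cs x = foldr′ (λ c r → c + x * r) 0# cs

  record IsRealClosedOrderedField : Set where
    field
      isOrderedField : IsOrderedField _≡_ _<_ _+_ _*_ -_ 0# 1#
      sqrt           : ∀ x → 0# < x → ∃[ y ] (y * y ≡ x)
      oddRoot        : ∀ n (cs : Vec Carrier (suc (2 ℕ.* n))) c → c ≢ 0# →
                       ∃[ x ] (evalPoly (cs ∷ʳ c) x ≡ 0#)

    orderedField : OrderedField
    orderedField = record { isOrderedField = isOrderedField }

  open ExtremaStrict _<_ public using (_<±_)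

  data Cell : Set where
    point    : Carrier → Cell
    interval : Carrier ± → Carrier ± → Cell

  infix 4 _∈ᶜ_
  _∈ᶜ_ : Carrier → Cell → Set
  x ∈ᶜ point p      = x ≡ p
  x ∈ᶜ interval l u = l <± [ x ] × [ x ] <± u

  open Semantics 𝔐 public

  IsOMinimal : Set₁
  IsOMinimal = (X : Pred (Vec Carrier 1) 0ℓ) → Definable X →
               Σ[ cs ∈ List Cell ] (∀ x → (x ∷ []) ∈ X ⇔ Any (x ∈ᶜ_) cs)

module _ {L : Language} (S : OrderedRingSymbols L) (T : Theory L) where

  ExpandsRCF : Set₁
  ExpandsRCF = (𝔐 : Structure L) → 𝔐 ⊨ᵀ T →
               OrderedRingReduct.IsRealClosedOrderedField S 𝔐

  IsOMinimalTheory : Set₁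
  IsOMinimalTheory = (𝔐 : Structure L) → 𝔐 ⊨ᵀ T → OrderedRingReduct.IsOMinimal S 𝔐

module DefinableSets {L : Language} (𝔐 : Structure L) where
  open Language L
  open Structure 𝔐
  open Semantics 𝔐

  private
    variable
      n m : ℕ

    mutual
      renameᵗ : (Fin n → Fin m) → Term L n → Term L m
      renameᵗ r (var i)    = var (r i)
      renameᵗ r (app f ts) = app f (renameᵗ* r ts)

      renameᵗ* : ∀ {l} → (Fin n → Fin m) → Vec (Term L n) l → Vec (Term L m) l
      renameᵗ* r []       = []
      renameᵗ* r (t ∷ ts) = renameᵗ r t ∷ renameᵗ* r ts

    lift : (Fin n → Fin m) → Fin (suc n) → Fin (suc m)
    lift r zero    = zero
    lift r (suc i) = suc (r i)

    rename : (Fin n → Fin m) → Formula L n → Formula L m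
    rename r ⊥̇          = ⊥̇
    rename r (s ≐̇ t)    = renameᵗ r s ≐̇ renameᵗ r t
    rename r (rel R ts) = rel R (renameᵗ* r ts)
    rename r (φ ∧̇ ψ)    = rename r φ ∧̇ rename r ψ
    rename r (φ ∨̇ ψ)    = rename r φ ∨̇ rename r ψ
    rename r (φ ⇒̇ ψ)    = rename r φ ⇒̇ rename r ψ
    rename r (∀̇ φ)      = ∀̇ rename (lift r) φ
    rename r (∃̇ φ)      = ∃̇ rename (lift r) φ

    Agree : (Fin n → Fin m) → Vec Carrier n → Vec Carrier m → Set
    Agree r ρ σ = ∀ i → lookup σ (r i) ≡ lookup ρ i

    agree-lift : {r : Fin n → Fin m} {ρ : Vec Carrier n} {σ : Vec Carrier m} →
                 Agree r ρ σ → ∀ x → Agree (lift r) (x ∷ ρ) (x ∷ σ)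
    agree-lift e x zero    = refl
    agree-lift e x (suc i) = e i

    mutual
      ⟦rename⟧ : {r : Fin n → Fin m} {ρ : Vec Carrier n} {σ : Vec Carrier m} →
                 Agree r ρ σ → ∀ t → ⟦ renameᵗ r t ⟧ σ ≡ ⟦ t ⟧ ρ
      ⟦rename⟧ e (var i)    = e i
      ⟦rename⟧ e (app f ts) = cong (func f) (⟦rename⟧* e ts)

      ⟦rename⟧* : ∀ {l} {r : Fin n → Fin m} {ρ : Vec Carrier n} {σ : Vec Carrier m} →
                  Agree r ρ σ → (ts : Vec (Term L n) l) →
                  ⟦ renameᵗ* r ts ⟧* σ ≡ ⟦ ts ⟧* ρ
      ⟦rename⟧* e []       = refl
      ⟦rename⟧* e (t ∷ ts) = cong₂ _∷_ (⟦rename⟧ e t) (⟦rename⟧* e ts)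

    mutual
      ⊨rename⁺ : {r : Fin n → Fin m} {ρ : Vec Carrier n} {σ : Vec Carrier m} →
                 Agree r ρ σ → ∀ φ → ρ ⊨ φ → σ ⊨ rename r φ
      ⊨rename⁺ e (s ≐̇ t)    p        =
        trans (⟦rename⟧ e s) (trans p (sym (⟦rename⟧ e t)))
      ⊨rename⁺ e (rel R ts) p        = subst (rels R) (sym (⟦rename⟧* e ts)) p
      ⊨rename⁺ e (φ ∧̇ ψ)    (p , q)  = ⊨rename⁺ e φ p , ⊨rename⁺ e ψ q
      ⊨rename⁺ e (φ ∨̇ ψ)    (inj₁ p) = inj₁ (⊨rename⁺ e φ p)
      ⊨rename⁺ e (φ ∨̇ ψ)    (inj₂ q) = inj₂ (⊨rename⁺ e ψ q)
      ⊨rename⁺ e (φ ⇒̇ ψ)    p q      = ⊨rename⁺ e ψ (p (⊨rename⁻ e φ q))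
      ⊨rename⁺ e (∀̇ φ)      p x      = ⊨rename⁺ (agree-lift e x) φ (p x)
      ⊨rename⁺ e (∃̇ φ)      (x , p)  = x , ⊨rename⁺ (agree-lift e x) φ p

      ⊨rename⁻ : {r : Fin n → Fin m} {ρ : Vec Carrier n} {σ : Vec Carrier m} →
                 Agree r ρ σ → ∀ φ → σ ⊨ rename r φ → ρ ⊨ φ
      ⊨rename⁻ e (s ≐̇ t)    p        =
        trans (sym (⟦rename⟧ e s)) (trans p (⟦rename⟧ e t))
      ⊨rename⁻ e (rel R ts) p        = subst (rels R) (⟦rename⟧* e ts) p
      ⊨rename⁻ e (φ ∧̇ ψ)    (p , q)  = ⊨rename⁻ e φ p , ⊨rename⁻ e ψ q
      ⊨rename⁻ e (φ ∨̇ ψ)    (inj₁ p) = inj₁ (⊨rename⁻ e φ p)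
      ⊨rename⁻ e (φ ∨̇ ψ)    (inj₂ q) = inj₂ (⊨rename⁻ e ψ q)
      ⊨rename⁻ e (φ ⇒̇ ψ)    p q      = ⊨rename⁻ e ψ (p (⊨rename⁺ e φ q))
      ⊨rename⁻ e (∀̇ φ)      p x      = ⊨rename⁻ (agree-lift e x) φ (p x)
      ⊨rename⁻ e (∃̇ φ)      (x , p)  = x , ⊨rename⁻ (agree-lift e x) φ p

    ⊨rename : {r : Fin n → Fin m} {ρ : Vec Carrier n} {σ : Vec Carrier m} →
              Agree r ρ σ → ∀ φ → (ρ ⊨ φ) ⇔ (σ ⊨ rename r φ)
    ⊨rename e φ = mk⇔ (⊨rename⁺ e φ) (⊨rename⁻ e φ)

    -- The renaming that acts as r on the first n variables and as s on the
    -- remaining (parameter) variables.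
    ⟨_∣_⟩ : ∀ {n n′ m m′} → (Fin n → Fin n′) → (Fin m → Fin m′) →
           Fin (n ℕ.+ m) → Fin (n′ ℕ.+ m′)
    ⟨_∣_⟩ {n} {n′} {m} {m′} r s i =
      [ (λ j → r j ↑ˡ m′) , (λ j → n′ ↑ʳ s j) ]′ (splitAt n i)

    agree-++ : ∀ {n n′ m m′} {r : Fin n → Fin n′} {s : Fin m → Fin m′}
               (x : Vec Carrier n) (x′ : Vec Carrier n′)
               (b : Vec Carrier m) (b′ : Vec Carrier m′) →
               Agree r x x′ → Agree s b b′ → Agree ⟨ r ∣ s ⟩ (x ++ b) (x′ ++ b′)
    agree-++ {n} {m = m} x x′ b b′ e e′ i with splitAt n i | join-splitAt n m i
    ... | inj₁ j | refl = trans (lookup-++ˡ x′ b′ _) (trans (e j) (sym (lookup-++ˡ x b j)))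
    ... | inj₂ j | refl = trans (lookup-++ʳ x′ b′ _) (trans (e′ j) (sym (lookup-++ʳ x b j)))

  definable-resp : {X Y : Pred (Vec Carrier n) 0ℓ} →
                   (∀ x → x ∈ Y ⇔ x ∈ X) → Definable X → Definable Y
  definable-resp eq (m , φ , b , e) = m , φ , b , λ x → e x ⇔-∘ eq x

  definable-reindex : {X : Pred (Vec Carrier n) 0ℓ} (r : Fin n → Fin m) → Definable X →
                      Definable {m} (λ x → tabulate (lookup x ∘ r) ∈ X)
  definable-reindex r (m , φ , b , e) = m , rename ⟨ r ∣ id ⟩ φ , b , λ x →
    ⊨rename (agree-++ (tabulate (lookup x ∘ r)) x b b
               (λ i → sym (lookup∘tabulate (lookup x ∘ r) i)) (λ _ → refl)) φ
    ⇔-∘ e (tabulate (lookup x ∘ r))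

  private
    weaken : {X : Pred (Vec Carrier n) 0ℓ} ((k , φ , b , e) : Definable X) →
             ∀ {l} (s : Fin k → Fin l) (b′ : Vec Carrier l) → Agree s b b′ →
             Σ[ ψ ∈ Formula L (n ℕ.+ l) ] (∀ x → x ∈ X ⇔ (x ++ b′ ⊨ ψ))
    weaken (k , φ , b , e) s b′ a = rename ⟨ id ∣ s ⟩ φ , λ x →
      ⊨rename (agree-++ x x b b′ (λ _ → refl) a) φ ⇔-∘ e x

  definable-∩ : {X Y : Pred (Vec Carrier n) 0ℓ} →
                Definable X → Definable Y → Definable (X ∩ Y)
  definable-∩ D@(k , _ , b , _) E@(l , _ , c , _)
    with φ , p ← weaken D (_↑ˡ l) (b ++ c) (lookup-++ˡ b c)
       | ψ , q ← weaken E (k ↑ʳ_) (b ++ c) (lookup-++ʳ b c) =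
    k ℕ.+ l , φ ∧̇ ψ , b ++ c , λ x →
      mk⇔ (λ (u , v) → to (p x) u , to (q x) v) (λ (u , v) → from (p x) u , from (q x) v)

  definable-∪ : {X Y : Pred (Vec Carrier n) 0ℓ} →
                Definable X → Definable Y → Definable (X ∪ Y)
  definable-∪ D@(k , _ , b , _) E@(l , _ , c , _)
    with φ , p ← weaken D (_↑ˡ l) (b ++ c) (lookup-++ˡ b c)
       | ψ , q ← weaken E (k ↑ʳ_) (b ++ c) (lookup-++ʳ b c) =
    k ℕ.+ l , φ ∨̇ ψ , b ++ c , λ x →
      mk⇔ (λ { (inj₁ u) → inj₁ (to (p x) u)   ; (inj₂ v) → inj₂ (to (q x) v) })
          (λ { (inj₁ u) → inj₁ (from (p x) u) ; (inj₂ v) → inj₂ (from (q x) v) })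

  definable-∃ : {X : Pred (Vec Carrier (suc n)) 0ℓ} → Definable X →
                Definable {n} (λ x → ∃[ y ] ((y ∷ x) ∈ X))
  definable-∃ (k , φ , b , e) = k , ∃̇ φ , b , λ x →
    mk⇔ (λ (y , p) → y , to (e (y ∷ x)) p) (λ (y , p) → y , from (e (y ∷ x)) p)

  private
    params : Vec Carrier n → Vec Carrier (n ℕ.+ 0)
    params x = x ++ []

    agree-[] : (x : Vec Carrier n) → Agree (_↑ˡ 0) x (params x)
    agree-[] x = lookup-++ˡ x []

  definable-≐ : (s t : Term L n) → Definable (λ x → ⟦ s ⟧ x ≡ ⟦ t ⟧ x)
  definable-≐ s t = 0 , rename (_↑ˡ 0) (s ≐̇ t) , [] , λ x → ⊨rename (agree-[] x) (s ≐̇ t)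

  definable-rel : ∀ {l} (R : Rels l) (ts : Vec (Term L n) l) →
                  Definable (λ x → rels R (⟦ ts ⟧* x))
  definable-rel R ts = 0 , rename (_↑ˡ 0) (rel R ts) , [] , λ x → ⊨rename (agree-[] x) (rel R ts)

module HardyField {L : Language} (S : OrderedRingSymbols L) (𝔐 : Structure L)
  (rcf  : OrderedRingReduct.IsRealClosedOrderedField S 𝔐)
  (omin : OrderedRingReduct.IsOMinimal S 𝔐)
  where

  open OrderedRingReduct S 𝔐
  open IsRealClosedOrderedField rcf using (orderedField)
  open OrderedField orderedField using
    (isCommutativeRing; isStrictTotalOrder; 0<1; invertible; +-monoˡ-<; *-pos)
  open OrderedRingSymbols S
  open DefinableSets 𝔐
  private
    module R = IsCommutativeRing isCommutativeRing
    module O = IsStrictTotalOrder isStrictTotalOrder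

  Eventually : Pred Carrier 0ℓ → Set
  Eventually P = ∃[ c ] (0# < c × (∀ t → 0# < t → t < c → P t))

  Graph : (Carrier → Carrier) → Pred (Vec Carrier 2) 0ℓ
  Graph f (t ∷ y ∷ []) = f t ≡ y

  -- Every germ at 0⁺ of a definable function has a representative that is
  -- defined on the whole carrier.
  record DefinableFunction : Set where
    field
      fun       : Carrier → Carrier
      definable : Definable (Graph fun)

  open DefinableFunction

  infix 4 _≈ᴷ_ _<ᴷ_

  _≈ᴷ_ _<ᴷ_ : Rel DefinableFunction 0ℓ
  f ≈ᴷ g = Eventually (λ t → fun f t ≡ fun g t)
  f <ᴷ g = Eventually (λ t → fun f t < fun g t)

  private
    0ᵗ 1ᵗ : ∀ {n} → Term L n
    0ᵗ = app zeroˢ []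
    1ᵗ = app oneˢ []

    both : ∀ f g → Definable {3} (λ { (v ∷ u ∷ t ∷ []) → fun f t ≡ u × fun g t ≡ v })
    both f g = definable-resp (λ { (v ∷ u ∷ t ∷ []) → ⇔-id _ })
      (definable-∩
        (definable-reindex (λ { 0F → 2F ; 1F → 1F }) (definable f))
        (definable-reindex (λ { 0F → 2F ; 1F → 0F }) (definable g)))

    op₂ : (o : Language.Func L 2) → DefinableFunction → DefinableFunction → DefinableFunction
    op₂ o f g = record
      { fun       = λ t → func o (fun f t ∷ fun g t ∷ [])
      ; definable = definable-resp
          (λ { (t ∷ y ∷ []) → mk⇔
            (λ p → _ , _ , (refl , refl) , p)
            (λ { (_ , _ , (refl , refl) , p) → p }) })
          (definable-∃ (definable-∃ (definable-∩
            (definable-reindex (λ { 0F → 0F ; 1F → 1F ; 2F → 2F }) (both f g))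
            (definable-≐ (app o (var 1F ∷ var 0F ∷ [])) (var 3F)))))
      }

    op₁ : (o : Language.Func L 1) → DefinableFunction → DefinableFunction
    op₁ o f = record
      { fun       = λ t → func o (fun f t ∷ [])
      ; definable = definable-resp
          (λ { (t ∷ y ∷ []) → mk⇔ (λ p → _ , refl , p) (λ { (_ , refl , p) → p }) })
          (definable-∃ (definable-∩
            (definable-reindex (λ { 0F → 1F ; 1F → 0F }) (definable f))
            (definable-≐ (app o (var 0F ∷ [])) (var 2F))))
      }

    op₀ : (o : Language.Func L 0) → DefinableFunction
    op₀ o = record
      { fun       = λ _ → func o []
      ; definable = definable-resp (λ { (t ∷ y ∷ []) → ⇔-id _ })
                      (definable-≐ (app o []) (var 1F))
      }

    definable-< : ∀ f g → Definable {1} (λ { (t ∷ []) → fun f t < fun g t })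
    definable-< f g = definable-resp
      (λ { (t ∷ []) → mk⇔ (λ p → _ , _ , (refl , refl) , p)
                          (λ { (_ , _ , (refl , refl) , p) → p }) })
      (definable-∃ (definable-∃ (definable-∩ (both f g)
        (definable-rel lessˢ (var 1F ∷ var 0F ∷ [])))))

    definable-≡ : ∀ f g → Definable {1} (λ { (t ∷ []) → fun f t ≡ fun g t })
    definable-≡ f g = definable-resp
      (λ { (t ∷ []) → mk⇔ (λ p → _ , _ , (refl , refl) , p)
                          (λ { (_ , _ , (refl , refl) , p) → p }) })
      (definable-∃ (definable-∃ (definable-∩ (both f g)
        (definable-≐ (var 1F) (var 0F)))))

  0ᴷ 1ᴷ : DefinableFunction
  0ᴷ = op₀ zeroˢ
  1ᴷ = op₀ oneˢ

  infix  8 -ᴷ_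
  infixl 7 _*ᴷ_
  infixl 6 _+ᴷ_

  _+ᴷ_ _*ᴷ_ : Op₂ DefinableFunction
  _+ᴷ_ = op₂ plusˢ
  _*ᴷ_ = op₂ multˢ

  -ᴷ_ : Op₁ DefinableFunction
  -ᴷ_ = op₁ negˢ

  private
    inverse : (x : Carrier) → ∃[ y ] ((x ≡ 0# × y ≡ 0#) ⊎ (x * y ≡ 1#))
    inverse x with O.compare x 0#
    ... | tri≈ _ p _ = 0# , inj₁ (p , refl)
    ... | tri< _ p _ = let (y , e) = invertible x p in y , inj₂ e
    ... | tri> _ p _ = let (y , e) = invertible x p in y , inj₂ e

    0≢1 : 0# ≢ 1#
    0≢1 p = O.irrefl p 0<1

    zeroˡ : ∀ x → 0# * x ≡ 0#
    zeroˡ x = R.zeroˡ x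

    inverse-unique : ∀ x y → (x ≡ 0# × y ≡ 0#) ⊎ (x * y ≡ 1#) → proj₁ (inverse x) ≡ y
    inverse-unique x y p with inverse x
    inverse-unique x y (inj₁ (_ , q))    | z , inj₁ (_ , r)    = trans r (sym q)
    inverse-unique x y (inj₁ (refl , _)) | z , inj₂ r          = ⊥-elim (0≢1 (trans (sym (zeroˡ z)) r))
    inverse-unique x y (inj₂ q)          | z , inj₁ (refl , _) = ⊥-elim (0≢1 (trans (sym (zeroˡ y)) q))
    inverse-unique x y (inj₂ q)          | z , inj₂ r          =
      trans (sym (R.*-identityʳ z)) (trans (cong (z *_) (sym q))
        (trans (sym (R.*-assoc z x y)) (trans (cong (_* y) (trans (R.*-comm z x) r))
          (R.*-identityˡ y))))

    invᴷ : DefinableFunction → DefinableFunction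
    invᴷ f = record
      { fun       = λ t → proj₁ (inverse (fun f t))
      ; definable = definable-resp
          (λ { (t ∷ y ∷ []) → mk⇔
            (λ { refl → _ , refl , proj₂ (inverse (fun f t)) })
            (λ { (_ , refl , p) → inverse-unique _ y p }) })
          (definable-∃ (definable-∩
            (definable-reindex (λ { 0F → 1F ; 1F → 0F }) (definable f))
            (definable-∪
              (definable-∩ (definable-≐ (var 0F) 0ᵗ) (definable-≐ (var 2F) 0ᵗ))
              (definable-≐ (app multˢ (var 0F ∷ var 2F ∷ [])) 1ᵗ))))
      }

    always : {P : Pred Carrier 0ℓ} → (∀ t → P t) → Eventually P
    always p = 1# , 0<1 , λ t _ _ → p t

    map-ev : {P Q : Pred Carrier 0ℓ} → (∀ {t} → P t → Q t) → Eventually P → Eventually Q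
    map-ev h (c , 0<c , p) = c , 0<c , λ t 0<t t<c → h (p t 0<t t<c)

    zip-ev : {P Q R : Pred Carrier 0ℓ} → (∀ {t} → P t → Q t → R t) →
             Eventually P → Eventually Q → Eventually R
    zip-ev h (c , 0<c , p) (d , 0<d , q) with O.compare c d
    ... | tri< c<d _ _    = c , 0<c , λ t l u → h (p t l u) (q t l (O.trans u c<d))
    ... | tri≈ _ refl _   = c , 0<c , λ t l u → h (p t l u) (q t l u)
    ... | tri> _ _ d<c    = d , 0<d , λ t l u → h (p t l (O.trans u d<c)) (q t l u)

    +-monoʳ-< : ∀ {x y} z → x < y → z + x < z + y
    +-monoʳ-< z p = subst₂ _<_ (R.+-comm _ z) (R.+-comm _ z) (+-monoˡ-< z p)

    +-pos : ∀ {x y} → 0# < x → 0# < y → 0# < x + y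
    +-pos {x} {y} p q = O.trans p (subst (_< x + y) (R.+-identityʳ x) (+-monoʳ-< x q))

    +-neg : ∀ {x y} → x < 0# → y < 0# → x + y < 0#
    +-neg {x} {y} p q = O.trans (subst (x + y <_) (R.+-identityʳ x) (+-monoʳ-< x q)) p

    half : ∀ c → 0# < c → ∃[ t ] (0# < t × t < c)
    half c 0<c = h , 0<h , subst₂ _<_ (R.+-identityʳ h) h+h≡c (+-monoʳ-< h 0<h)
      where
      2# = 1# + 1#
      2⁻¹ = invertible 2# (λ p → O.irrefl (sym p) (+-pos 0<1 0<1))
      h  = c * proj₁ 2⁻¹
      h+h≡c : h + h ≡ c
      h+h≡c = trans (cong₂ _+_ (sym (R.*-identityʳ h)) (sym (R.*-identityʳ h)))
        (trans (sym (R.distribˡ h 1# 1#)) (trans (R.*-assoc c _ 2#)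
          (trans (cong (c *_) (trans (R.*-comm _ 2#) (proj₂ 2⁻¹))) (R.*-identityʳ c))))
      0<h : 0# < h
      0<h with O.compare 0# h
      ... | tri< p _ _ = p
      ... | tri≈ _ p _ = ⊥-elim (O.irrefl
                           (trans (sym (R.+-identityˡ 0#)) (trans (cong₂ _+_ p p) h+h≡c)) 0<c)
      ... | tri> _ _ p = ⊥-elim (O.asym 0<c (subst (_< 0#) h+h≡c (+-neg p p)))

    absurd-ev : {P Q : Pred Carrier 0ℓ} → (∀ {t} → P t → Q t → ⊥) →
                Eventually P → Eventually Q → ⊥
    absurd-ev h p q =
      let (c , 0<c , r)   = zip-ev h p q
          (t , 0<t , t<c) = half c 0<c
      in r t 0<t t<c

    -- An o-minimal set contains, or is disjoint from, an interval (0 , c).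

    Decided : Pred Carrier 0ℓ → Set
    Decided P = Eventually P ⊎ Eventually (λ t → ¬ P t)

    decided-above : ∀ l → Decided (λ t → l <± [ t ])
    decided-above ⊥± = inj₁ (always λ t → ExtremaStrict.⊥±<[ t ])
    decided-above ⊤± = inj₂ (always λ _ ())
    decided-above [ l ] with O.compare 0# l
    ... | tri< p _ _    = inj₂ (l , p , λ t _ t<l l<t → O.asym t<l (ExtremaStrict.[<]-injective _<_ l<t))
    ... | tri≈ _ refl _ = inj₁ (1# , 0<1 , λ t 0<t _ → ExtremaStrict.[ 0<t ])
    ... | tri> _ _ p    = inj₁ (1# , 0<1 , λ t 0<t _ → ExtremaStrict.[ O.trans p 0<t ])

    decided-below : ∀ u → Decided (λ t → [ t ] <± u)
    decided-below ⊥± = inj₂ (always λ { _ SupremumStrict.[ () ] })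
    decided-below ⊤± = inj₁ (always λ t → ExtremaStrict.[ t ]<⊤±)
    decided-below [ u ] with O.compare 0# u
    ... | tri< p _ _    = inj₁ (u , p , λ t _ t<u → ExtremaStrict.[ t<u ])
    ... | tri≈ _ refl _ = inj₂ (1# , 0<1 , λ t 0<t _ t<u → O.asym 0<t (ExtremaStrict.[<]-injective _<_ t<u))
    ... | tri> _ _ p    = inj₂ (1# , 0<1 , λ t 0<t _ t<u →
                            O.asym p (O.trans 0<t (ExtremaStrict.[<]-injective _<_ t<u)))

    decided-cell : ∀ C → Decided (_∈ᶜ C)
    decided-cell (point p) with O.compare 0# p
    ... | tri< 0<p _ _  = inj₂ (p , 0<p , λ t _ t<p t≡p → O.irrefl t≡p t<p)
    ... | tri≈ _ refl _ = inj₂ (1# , 0<1 , λ t 0<t _ t≡p → O.irrefl (sym t≡p) 0<t)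
    ... | tri> _ _ p<0  = inj₂ (1# , 0<1 , λ { t 0<t _ refl → O.asym p<0 0<t })
    decided-cell (interval l u) with decided-above l | decided-below u
    ... | inj₁ p | inj₁ q = inj₁ (zip-ev _,_ p q)
    ... | inj₂ p | _      = inj₂ (map-ev (λ n (l<t , _) → n l<t) p)
    ... | _      | inj₂ q = inj₂ (map-ev (λ n (_ , t<u) → n t<u) q)

    decided-cells : ∀ Cs → Decided (λ t → Any (t ∈ᶜ_) Cs)
    decided-cells [] = inj₂ (always λ _ ())
    decided-cells (C ∷ Cs) with decided-cell C | decided-cells Cs
    ... | inj₁ p | _      = inj₁ (map-ev here p)
    ... | _      | inj₁ q = inj₁ (map-ev there q)
    ... | inj₂ p | inj₂ q = inj₂ (zip-ev (λ { n m (here x) → n x ; n m (there x) → m x }) p q)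

    decided : {X : Pred (Vec Carrier 1) 0ℓ} → Definable X → Decided (λ t → (t ∷ []) ∈ X)
    decided D with omin _ D
    ... | Cs , e with decided-cells Cs
    ...   | inj₁ p = inj₁ (map-ev (λ {t} → from (e t)) p)
    ...   | inj₂ p = inj₂ (map-ev (λ {t} n x → n (to (e t) x)) p)

    compareᴷ : Trichotomous _≈ᴷ_ _<ᴷ_
    compareᴷ f g with decided (definable-< f g) | decided (definable-≡ f g)
    ... | inj₁ p | _ = tri< p (absurd-ev (λ a b → O.irrefl b a) p) (absurd-ev O.asym p)
    ... | inj₂ p | inj₁ q =
      tri≈ (absurd-ev (λ a b → O.irrefl a b) q) q (absurd-ev (λ a b → O.irrefl (sym a) b) q)
    ... | inj₂ p | inj₂ q = tri> (absurd-ev id p) (absurd-ev id q) (zip-ev pick p q)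
      where
      pick : ∀ {x y} → ¬ (x < y) → x ≢ y → y < x
      pick {x} {y} n m with O.compare x y
      ... | tri< a _ _ = ⊥-elim (n a)
      ... | tri≈ _ a _ = ⊥-elim (m a)
      ... | tri> _ _ a = a

    isEquivalenceᴷ : IsEquivalence _≈ᴷ_
    isEquivalenceᴷ = record
      { refl = always λ _ → refl ; sym = map-ev sym ; trans = zip-ev trans }

  isOrderedFieldᴷ : IsOrderedField _≈ᴷ_ _<ᴷ_ _+ᴷ_ _*ᴷ_ -ᴷ_ 0ᴷ 1ᴷ
  isOrderedFieldᴷ = record
    { isCommutativeRing = record
      { isRing = record
        { +-isAbelianGroup = record
          { isGroup = record
            { isMonoid = record
              { isSemigroup = record
                { isMagma = record
                  { isEquivalence = isEquivalenceᴷ ; ∙-cong = zip-ev (cong₂ _+_) }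
                ; assoc = λ _ _ _ → always λ _ → R.+-assoc _ _ _
                }
              ; identity = (λ _ → always λ _ → R.+-identityˡ _)
                         , (λ _ → always λ _ → R.+-identityʳ _)
              }
            ; inverse = (λ _ → always λ _ → R.-‿inverseˡ _)
                      , (λ _ → always λ _ → R.-‿inverseʳ _)
            ; ⁻¹-cong = map-ev (cong -_)
            }
          ; comm = λ _ _ → always λ _ → R.+-comm _ _
          }
        ; *-cong     = zip-ev (cong₂ _*_)
        ; *-assoc    = λ _ _ _ → always λ _ → R.*-assoc _ _ _
        ; *-identity = (λ _ → always λ _ → R.*-identityˡ _)
                     , (λ _ → always λ _ → R.*-identityʳ _)
        ; distrib    = (λ _ _ _ → always λ _ → R.distribˡ _ _ _)
                     , (λ _ _ _ → always λ _ → R.distribʳ _ _ _)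
        }
      ; *-comm = λ _ _ → always λ _ → R.*-comm _ _
      }
    ; isStrictTotalOrder = record
      { isStrictPartialOrder = record
        { isEquivalence = isEquivalenceᴷ
        ; irrefl        = λ p q → absurd-ev O.irrefl p q
        ; trans         = zip-ev O.trans
        ; <-resp-≈      = zip-ev (λ e p → subst (_ <_) e p) , zip-ev (λ e p → subst (_< _) e p)
        }
      ; compare = compareᴷ
      }
    ; 0<1        = always λ _ → 0<1
    ; invertible = inverseᴷ
    ; +-monoˡ-<  = λ _ → map-ev (+-monoˡ-< _)
    ; *-pos      = zip-ev *-pos
    }
    where
    inverseᴷ : ∀ f → ¬ (f ≈ᴷ 0ᴷ) → ∃[ g ] (f *ᴷ g ≈ᴷ 1ᴷ)
    inverseᴷ f f≉0 with decided (definable-≡ f 0ᴷ)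
    ... | inj₁ p = ⊥-elim (f≉0 p)
    ... | inj₂ p = invᴷ f , map-ev (λ {t} n → case proj₂ (inverse (fun f t)) of λ
                     { (inj₁ (z , _)) → ⊥-elim (n z) ; (inj₂ e) → e }) p

  𝒦 : OrderedField
  𝒦 = record { isOrderedField = isOrderedFieldᴷ }

module CurveGerms {L : Language} (S : OrderedRingSymbols L) (𝔐 : Structure L)
  (rcf  : OrderedRingReduct.IsRealClosedOrderedField S 𝔐)
  (omin : OrderedRingReduct.IsOMinimal S 𝔐)
  where

  open OrderedRingReduct S 𝔐
  open IsRealClosedOrderedField rcf using (orderedField)
  open OrderedField orderedField using (_≤_; _⊔_; ∣_∣; isStrictTotalOrder)
  open HardyField S 𝔐 rcf omin using (Eventually; DefinableFunction; 𝒦)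
  private
    module O = IsStrictTotalOrder isStrictTotalOrder
    module 𝒦 = OrderedField 𝒦

  dist : ∀ {k} → Vec Carrier k → Vec Carrier k → Carrier
  dist x y = foldr′ _⊔_ 0# (zipWith (λ u v → ∣ u + - v ∣) x y)

  Ball : ∀ {k} → Vec Carrier k → Carrier → Pred (Vec Carrier k) 0ℓ
  Ball a ε x = dist a x < ε

  IsSupremum IsInfimum : Pred Carrier 0ℓ → Carrier → Set
  IsSupremum X s = (∀ x → x ∈ X → x ≤ s) × (∀ u → (∀ x → x ∈ X → x ≤ u) → s ≤ u)
  IsInfimum  X s = (∀ x → x ∈ X → s ≤ x) × (∀ l → (∀ x → x ∈ X → l ≤ x) → l ≤ s)

  IsPointSetDistance : ∀ {k} → Vec Carrier k → Pred (Vec Carrier k) 0ℓ → Carrier → Set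
  IsPointSetDistance x Y = IsInfimum (λ r → ∃[ y ] (y ∈ Y × r ≡ dist x y))

  IsExcess : ∀ {k} → (X Y : Pred (Vec Carrier k) 0ℓ) → Carrier → Set
  IsExcess X Y = IsSupremum (λ r → ∃[ x ] (x ∈ X × IsPointSetDistance x Y r))

  -- Suprema and infima in 𝔐 need not exist, so the Hausdorff distance is
  -- given as a (single-valued) relation between two sets and its value.
  IsHausdorffDistance : ∀ {k} → (X Y : Pred (Vec Carrier k) 0ℓ) → Carrier → Set
  IsHausdorffDistance X Y r =
    ∃[ s ] ∃[ s′ ] (IsExcess X Y s × IsExcess Y X s′ × r ≡ s ⊔ s′)

  InUnitInterval : Pred Carrier 0ℓ
  InUnitInterval t = 0# < t × t < 1#

  CurveGraph : ∀ {k} → (Carrier → Vec Carrier k) → Pred (Vec Carrier (suc k)) 0ℓ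
  CurveGraph f (t ∷ y) = InUnitInterval t × f t ≡ y

  -- Only the restriction of fun to (0 , 1) matters.
  record Curve {k} (a : Vec Carrier k) : Set where
    field
      fun        : Carrier → Vec Carrier k
      definable  : Definable (CurveGraph fun)
      continuous : ∀ t → InUnitInterval t → ∀ ε → 0# < ε →
                   ∃[ δ ] (0# < δ × (∀ s → InUnitInterval s →
                     ∣ s + - t ∣ < δ → dist (fun s) (fun t) < ε))
      limit      : ∀ ε → 0# < ε →
                   ∃[ δ ] (0# < δ × (∀ s → InUnitInterval s → s < δ → dist (fun s) a < ε))

    Image : Pred (Vec Carrier k) 0ℓ
    Image x = ∃[ t ] (InUnitInterval t × fun t ≡ x)

  open Curve

  module _ {k} {a : Vec Carrier k} where

    infix 4 _∼_ _≈ᴳ_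

    _∼_ : Rel (Curve a) 0ℓ
    γ ∼ σ = ∃[ ε ] (0# < ε × (Ball a ε ∩ Image γ ≐ Ball a ε ∩ Image σ))

    -- A curve may or may not run through its own limit a at a positive time,
    -- and the Hausdorff distance cannot see this: in dimension one, a curve at
    -- 0 with image (0 , 1) and one with image [0 , 1) have Hausdorff distance 0
    -- on every ball around 0 but are not related by _∼_.  Germs are therefore
    -- compared with the limit a adjoined to both images, which is how _∼_
    -- behaves for curves viewed as functions on [0 , 1) with value a at 0.
    _≈ᴳ_ : Rel (Curve a) 0ℓ
    γ ≈ᴳ σ = ∃[ ε ] (0# < ε × (Ball a ε ∩ (Image γ ∪ ｛ a ｝) ≐ Ball a ε ∩ (Image σ ∪ ｛ a ｝)))

    ∼⇒≈ᴳ : ∀ {γ σ} → γ ∼ σ → γ ≈ᴳ σ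
    ∼⇒≈ᴳ {γ} {σ} (ε , 0<ε , p , q) = ε , 0<ε , extend γ σ p , extend σ γ q
      where
      extend : ∀ γ σ → (∀ {x} → x ∈ Ball a ε ∩ Image γ → x ∈ Ball a ε ∩ Image σ) →
               ∀ {x} → x ∈ Ball a ε ∩ (Image γ ∪ ｛ a ｝) → x ∈ Ball a ε ∩ (Image σ ∪ ｛ a ｝)
      extend _ _ h (b , inj₁ i) = map₂ inj₁ (h (b , i))
      extend _ _ h (b , inj₂ e) = b , inj₂ e

    ≈ᴳ⇒∼ : ∀ {γ σ} → (a ∈ Image γ ⇔ a ∈ Image σ) → γ ≈ᴳ σ → γ ∼ σ
    ≈ᴳ⇒∼ {γ} {σ} at-a (ε , 0<ε , p , q) =
      ε , 0<ε , restrict γ σ (to at-a) p , restrict σ γ (from at-a) q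
      where
      restrict : ∀ γ σ → (a ∈ Image γ → a ∈ Image σ) →
                 (∀ {x} → x ∈ Ball a ε ∩ (Image γ ∪ ｛ a ｝) → x ∈ Ball a ε ∩ (Image σ ∪ ｛ a ｝)) →
                 ∀ {x} → x ∈ Ball a ε ∩ Image γ → x ∈ Ball a ε ∩ Image σ
      restrict _ _ h p (b , i) with p (b , inj₁ i)
      ... | _ , inj₁ j    = b , j
      ... | _ , inj₂ refl = b , h i

    ≈ᴳ-isEquivalence : IsEquivalence _≈ᴳ_
    ≈ᴳ-isEquivalence = record
      { refl  = 1# , OrderedField.0<1 orderedField , id , id
      ; sym   = λ (ε , 0<ε , p , q) → ε , 0<ε , q , p
      ; trans = λ {γ} {σ} {τ} → trans′ {γ} {σ} {τ}
      }
      where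
      trans′ : ∀ {γ σ τ} → γ ≈ᴳ σ → σ ≈ᴳ τ → γ ≈ᴳ τ
      trans′ (ε , 0<ε , p , q) (η , 0<η , p′ , q′) with O.compare ε η
      ... | tri< ε<η _ _ = ε , 0<ε
        , (λ (b , i) → b , proj₂ (p′ (O.trans b ε<η , proj₂ (p (b , i)))))
        , (λ (b , i) → q (b , proj₂ (q′ (O.trans b ε<η , i))))
      ... | tri≈ _ refl _ = ε , 0<ε , p′ ∘ p , q ∘ q′
      ... | tri> _ _ η<ε = η , 0<η
        , (λ (b , i) → p′ (b , proj₂ (p (O.trans b η<ε , i))))
        , (λ (b , i) → b , proj₂ (q (O.trans b η<ε , proj₂ (q′ (b , i)))))

  𝒢 : ∀ {k} → Vec Carrier k → Setoid 0ℓ 0ℓ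
  𝒢 a = record { Carrier = Curve a ; isEquivalence = ≈ᴳ-isEquivalence }

  RepresentsDistance : ∀ {k} {a : Vec Carrier k} → Curve a → Curve a → DefinableFunction → Set
  RepresentsDistance {a = a} γ σ f = Eventually λ t →
    IsHausdorffDistance (Ball a t ∩ Image γ) (Ball a t ∩ Image σ) (DefinableFunction.fun f t)

  -- The function d is determined by the representatives up to equality of
  -- germs: d γ σ is the germ of f exactly when f represents the distance.
  IsGermDistance : ∀ {k} (a : Vec Carrier k) → (Curve a → Curve a → DefinableFunction) → Set
  IsGermDistance a d = ∀ γ σ f → f 𝒦.≈ d γ σ ⇔ RepresentsDistance γ σ f

  Is𝒦-Metric : ∀ {k} (a : Vec Carrier k) → (Curve a → Curve a → DefinableFunction) → Set
  Is𝒦-Metric a = IsGeneralMetric (Setoid._≈_ (𝒢 a)) 𝒦._≈_ 𝒦._≤_ 𝒦.0# 𝒦._+_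

{-# OPTIONS --safe #-}

-- For sets X and Y the Hausdorff distance is the cut of the r for which every
-- point of X is within r of Y and conversely.  For the traces of two curves on
-- B(a , t) this relation is definable in (t , r), so by o-minimality the cut
-- exists and is a definable function of t.  Symmetry and the triangle inequality
-- hold for cuts, and adjoining a changes nothing because a is a limit of each trace.
--
-- If the distance vanishes, each trace lies in the closure of the other.  The
-- closure of a curve σ adds to its image only a and possibly a limit at 1: away
-- from a and Image σ a point has positive distance to every σ((0 , t)) with t < 1,
-- by continuity and definable completeness.  By o-minimality such a limit is
-- unique, so a small ball around a avoids it.

module Submission where

open import Defs
import Algebra.Construct.NaturalChoice.Max as Max
open import Algebra.Core using (Op₁; Op₂)
open import Algebra.Bundles using (AbelianGroup)
import Algebra.Properties.AbelianGroup as AbelianGroupProperties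
open import Algebra.Structures using (IsCommutativeRing)
open import Axiom.ExcludedMiddle using (ExcludedMiddle)
open import Data.Empty using (⊥-elim)
open import Data.Fin.Base using (Fin; zero; suc; _↑ˡ_; _↑ʳ_)
open import Data.Fin.Patterns using (0F; 1F; 2F; 3F; 4F)
open import Data.List.Base using (List; []; _∷_)
open import Data.List.Relation.Unary.Any using (Any; here; there)
open import Data.Nat.Base as ℕ using (ℕ; zero; suc)
open import Data.Product.Base using (∃-syntax; _×_; _,_; proj₁; proj₂)
open import Data.Sum.Base using (_⊎_; inj₁; inj₂)
open import Data.Vec.Base using (Vec; []; _∷_; lookup; tabulate; _++_)
open import Data.Vec.Properties using (lookup-++ˡ; lookup-++ʳ; tabulate∘lookup; tabulate-cong)
open import Function.Base using (_∘_; id)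
open import Function.Bundles using (_⇔_; mk⇔; Equivalence)
open import Level using (0ℓ)
open import Relation.Binary.Bundles using (TotalOrder)
open import Relation.Binary.Core using (Rel)
open import Relation.Binary.Definitions using (tri<; tri≈; tri>)
open import Relation.Binary.PropositionalEquality
  using (_≡_; _≢_; refl; sym; trans; cong; cong₂; subst; subst₂)
open import Relation.Binary.Structures using (IsEquivalence; IsStrictTotalOrder)
import Relation.Binary.Construct.Add.Extrema.Strict as ExtremaStrict
import Relation.Binary.Construct.Add.Supremum.Strict as SupremumStrict
open import Relation.Nullary.Construct.Add.Extrema using (⊥±; ⊤±; [_])
open import Relation.Nullary.Decidable.Core using (Dec; yes; no; decidable-stable)
open import Relation.Nullary.Negation using (¬_)
open import Relation.Unary using (Pred; _∈_; _∩_; _∪_; ｛_｝)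

open Equivalence using (to; from)

-- Order arithmetic in an ordered field.

module OrderedFieldProperties
  {A : Set} {_<_ : Rel A 0ℓ} {_+_ _*_ : Op₂ A} { -_ : Op₁ A} {0# 1# : A}
  (F : IsOrderedField _≡_ _<_ _+_ _*_ -_ 0# 1#) where

  open IsOrderedField F
  open IsCommutativeRing isCommutativeRing using (+-comm) public
  private
    module R = IsCommutativeRing isCommutativeRing
    module O = IsStrictTotalOrder isStrictTotalOrder
    +-abelianGroup : AbelianGroup 0ℓ 0ℓ
    +-abelianGroup = record { isAbelianGroup = R.+-isAbelianGroup }
    module G = AbelianGroupProperties +-abelianGroup
    orderedField : OrderedField
    orderedField = record { isOrderedField = F }
  open OrderedField orderedField using (_≤_; _⊔_; ∣_∣; totalOrder)
  private module M = Max totalOrder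

  <-irrefl : ∀ {x} → ¬ (x < x)
  <-irrefl = O.irrefl refl

  ≤⇒≯ : ∀ {x y} → x ≤ y → ¬ (y < x)
  ≤⇒≯ (inj₁ x<y)  y<x = O.asym x<y y<x
  ≤⇒≯ (inj₂ refl) y<x = <-irrefl y<x

  ≮⇒≥ : ∀ {x y} → ¬ (x < y) → y ≤ x
  ≮⇒≥ {x} {y} x≮y with O.compare x y
  ... | tri< x<y _ _ = ⊥-elim (x≮y x<y)
  ... | tri≈ _ x≡y _ = inj₂ (sym x≡y)
  ... | tri> _ _ y<x = inj₁ y<x

  ≤-<-trans : ∀ {x y z} → x ≤ y → y < z → x < z
  ≤-<-trans (inj₁ x<y)  y<z = O.trans x<y y<z
  ≤-<-trans (inj₂ refl) y<z = y<z

  <-≤-trans : ∀ {x y z} → x < y → y ≤ z → x < z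
  <-≤-trans x<y (inj₁ y<z)  = O.trans x<y y<z
  <-≤-trans x<y (inj₂ refl) = x<y

  ≮-antisym : ∀ {x y} → ¬ (x < y) → ¬ (y < x) → x ≡ y
  ≮-antisym {x} {y} x≮y y≮x with O.compare x y
  ... | tri< x<y _ _ = ⊥-elim (x≮y x<y)
  ... | tri≈ _ x≡y _ = x≡y
  ... | tri> _ _ y<x = ⊥-elim (y≮x y<x)

  +-monoʳ-< : ∀ {x y} z → x < y → (z + x) < (z + y)
  +-monoʳ-< z x<y = subst₂ _<_ (R.+-comm _ z) (R.+-comm _ z) (+-monoˡ-< z x<y)

  +-mono-< : ∀ {x y u v} → x < y → u < v → (x + u) < (y + v)
  +-mono-< {y = y} {u = u} x<y u<v = O.trans (+-monoˡ-< u x<y) (+-monoʳ-< y u<v)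

  x<x+y : ∀ x {y} → 0# < y → x < (x + y)
  x<x+y x {y} 0<y = subst (_< (x + y)) (R.+-identityʳ x) (+-monoʳ-< x 0<y)

  +-pos : ∀ {x y} → 0# < x → 0# < y → 0# < (x + y)
  +-pos {x} 0<x 0<y = O.trans 0<x (x<x+y x 0<y)

  x-y<x : ∀ x {y} → 0# < y → (x + (- y)) < x
  x-y<x x {y} 0<y = subst ((x + (- y)) <_) (G.//-rightDividesˡ y x) (x<x+y (x + (- y)) 0<y)

  x+[y-x]≡y : ∀ x y → (x + (y + (- x))) ≡ y
  x+[y-x]≡y x y = trans (R.+-comm x _) (G.//-rightDividesˡ x y)

  x-[x-y]≡y : ∀ x y → (x + (- (x + (- y)))) ≡ y
  x-[x-y]≡y x y = trans (cong (x +_) (G.⁻¹-anti-homo‿- x y))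
    (x+[y-x]≡y x y)

  x<y⇒0<y-x : ∀ {x y} → x < y → 0# < (y + (- x))
  x<y⇒0<y-x {x} x<y = subst (_< _) (R.-‿inverseʳ x) (+-monoˡ-< (- x) x<y)

  x+z<y⇒x<y-z : ∀ {x y z} → (x + z) < y → x < (y + (- z))
  x+z<y⇒x<y-z {x} {z = z} p = subst (_< _) (G.//-rightDividesʳ z x) (+-monoˡ-< (- z) p)

  x<y-z⇒x+z<y : ∀ {x y z} → x < (y + (- z)) → (x + z) < y
  x<y-z⇒x+z<y {y = y} {z} p = subst (_ <_) (G.//-rightDividesˡ z y) (+-monoˡ-< z p)

  x-y<z⇒x<z+y : ∀ {x y z} → (x + (- y)) < z → x < (z + y)
  x-y<z⇒x<z+y {x} {y} p = subst (_< _) (G.//-rightDividesˡ y x) (+-monoˡ-< y p)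

  x<z+y⇒x-y<z : ∀ {x y z} → x < (z + y) → (x + (- y)) < z
  x<z+y⇒x-y<z {y = y} {z} p = subst (_ <_) (G.//-rightDividesʳ y z) (+-monoˡ-< (- y) p)

  halve : ∀ {c} → 0# < c → ∃[ h ] (0# < h × (h + h) ≡ c)
  halve {c} 0<c = h , 0<h , h+h≡c
    where
    2⁻¹ = invertible (1# + 1#) (λ p → O.irrefl (sym p) (+-pos 0<1 0<1))
    h   = c * proj₁ 2⁻¹
    h+h≡c : (h + h) ≡ c
    h+h≡c = trans (cong₂ _+_ (sym (R.*-identityʳ h)) (sym (R.*-identityʳ h)))
      (trans (sym (R.distribˡ h 1# 1#)) (trans (R.*-assoc c _ _)
        (trans (cong (c *_) (trans (R.*-comm _ _) (proj₂ 2⁻¹))) (R.*-identityʳ c))))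
    0<h : 0# < h
    -- The sign of `h` is read off from `h + h`: were `h` zero or negative, so would be `c`.
    0<h with O.compare 0# h
    ... | tri< p _ _    = p
    ... | tri≈ _ 0≡h _  = ⊥-elim (O.irrefl
      (trans (sym (R.+-identityˡ 0#)) (trans (cong₂ _+_ 0≡h 0≡h) h+h≡c)) 0<c)
    ... | tri> _ _ h<0  = ⊥-elim (O.asym 0<c
      (subst₂ _<_ h+h≡c (R.+-identityˡ 0#) (+-mono-< h<0 h<0)))

  <-dense : ∀ {x y} → x < y → ∃[ z ] (x < z × z < y)
  <-dense {x} {y} x<y with halve (x<y⇒0<y-x x<y)
  ... | h , 0<h , h+h≡y-x = x + h , x<x+y x 0<h , subst ((x + h) <_) x+h+h≡y (x<x+y _ 0<h)
    where
    x+h+h≡y : ((x + h) + h) ≡ y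
    x+h+h≡y = trans (R.+-assoc x h h) (trans (cong (x +_) h+h≡y-x) (x+[y-x]≡y x y))

  below₂ : ∀ {x c d} → x < c → x < d → ∃[ z ] (x < z × z < c × z < d)
  below₂ {c = c} {d} x<c x<d with O.compare c d
  ... | tri< c<d _ _  = let (z , l , u) = <-dense x<c in z , l , u , O.trans u c<d
  ... | tri≈ _ refl _ = let (z , l , u) = <-dense x<c in z , l , u , u
  ... | tri> _ _ d<c  = let (z , l , u) = <-dense x<d in z , l , O.trans u d<c , u

  above₂ : ∀ {a b x} → a < x → b < x → ∃[ z ] (a < z × b < z × z < x)
  above₂ {a} {b} a<x b<x with O.compare a b
  ... | tri< a<b _ _  = let (z , l , u) = <-dense b<x in z , O.trans a<b l , l , u
  ... | tri≈ _ refl _ = let (z , l , u) = <-dense a<x in z , l , l , u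
  ... | tri> _ _ b<a  = let (z , l , u) = <-dense a<x in z , l , O.trans b<a l , u

  unbounded₂ : ∀ x y → ∃[ z ] (x < z × y < z)
  unbounded₂ x y with O.compare x y
  ... | tri< x<y _ _  = y + 1# , O.trans x<y (x<x+y y 0<1) , x<x+y y 0<1
  ... | tri≈ _ refl _ = y + 1# , x<x+y y 0<1 , x<x+y y 0<1
  ... | tri> _ _ y<x  = x + 1# , x<x+y x 0<1 , O.trans y<x (x<x+y x 0<1)

  ⊔-<-⇔ : ∀ x y r → ((x ⊔ y) < r) ⇔ (x < r × y < r)
  ⊔-<-⇔ x y r = mk⇔
    (λ p → ≤-<-trans (M.x≤x⊔y x y) p , ≤-<-trans (M.x≤y⊔x x y) p)
    λ (p , q) → lub p q
    where
    lub : x < r → y < r → (x ⊔ y) < r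
    lub p q with M.⊔-sel x y
    ... | inj₁ e = subst (_< r) (sym e) p
    ... | inj₂ e = subst (_< r) (sym e) q

  ⊔-≤ : ∀ {x y r} → x ≤ r → y ≤ r → (x ⊔ y) ≤ r
  ⊔-≤ = M.⊔-lub

  -- Removes absolute value and subtraction, so that closeness can be written as a formula in `+`
  -- and `<` alone.
  ∣x-y∣<-⇔ : ∀ x y r → (∣ x + (- y) ∣ < r) ⇔ (x < (r + y) × y < (r + x))
  ∣x-y∣<-⇔ x y r = mk⇔
    (λ p → let (q , q′) = to (⊔-<-⇔ _ _ r) p in
      x-y<z⇒x<z+y q , x-y<z⇒x<z+y (subst (_< r) (G.⁻¹-anti-homo‿- x y) q′))
    (λ (p , q) → from (⊔-<-⇔ _ _ r)
      ( x<z+y⇒x-y<z p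
      , subst (_< r) (sym (G.⁻¹-anti-homo‿- x y)) (x<z+y⇒x-y<z q)))

-- Further closure properties of definable sets.

module DefinableSetsProperties {L : Language} (𝔐 : Structure L) where
  open Structure 𝔐
  open Semantics 𝔐
  open DefinableSets 𝔐

  private
    variable
      n : ℕ
      X : Pred (Vec Carrier n) 0ℓ

  definable-¬ : Definable X → Definable (λ x → ¬ (x ∈ X))
  definable-¬ (m , φ , b , e) = m , ¬̇ φ , b , λ x →
    mk⇔ (λ x∉X p → x∉X (from (e x) p)) (λ x⊭φ p → x⊭φ (to (e x) p))

  definable-∀ : {X : Pred (Vec Carrier (suc n)) 0ℓ} → Definable X →
                Definable {n} (λ x → ∀ y → (y ∷ x) ∈ X)
  definable-∀ (m , φ , b , e) = m , ∀̇ φ , b , λ x →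
    mk⇔ (λ p y → to (e (y ∷ x)) (p y)) (λ p y → from (e (y ∷ x)) (p y))

  -- The two sets come with different parameter lists, which `definable-∩` merges; hence the
  -- implication is read classically, as the negation of a conjunction.
  definable-⇒ : ExcludedMiddle 0ℓ → {X Y : Pred (Vec Carrier n) 0ℓ} →
                Definable X → Definable Y → Definable (λ x → x ∈ X → x ∈ Y)
  definable-⇒ em {X} {Y} D E = definable-resp
    (λ x → mk⇔ (λ f p → proj₂ p (f (proj₁ p))) (λ ¬p x∈X → decidable-stable em (λ x∉Y → ¬p (x∈X , x∉Y))))
    (definable-¬ (definable-∩ {X = X} D (definable-¬ E)))

  -- The index ranges over coordinates and not over the structure, so the conjunction is assembled
  -- outside the language by recursion on `k`.
  definable-⋀ : ∀ {k} {X : Fin k → Pred (Vec Carrier n) 0ℓ} →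
                (∀ i → Definable (X i)) → Definable (λ x → ∀ i → x ∈ X i)
  definable-⋀ {k = zero}      D = 0 , ¬̇ ⊥̇ , [] , λ x → mk⇔ (λ _ → id) (λ _ ())
  definable-⋀ {k = suc k} {X} D = definable-resp
    (λ x → mk⇔ (λ p → p zero , p ∘ suc) (λ { (p , q) zero → p ; (p , q) (suc i) → q i }))
    (definable-∩ (D zero) (definable-⋀ {X = X ∘ suc} (D ∘ suc)))

  definable-const : ∀ (i : Fin n) c → Definable (λ x → lookup x i ≡ c)
  definable-const {n} i c = 1 , var (i ↑ˡ 1) ≐̇ var (n ↑ʳ 0F) , c ∷ [] , λ x →
    mk⇔ (subst₂ _≡_ (sym (lookup-++ˡ x (c ∷ []) i)) (sym (lookup-++ʳ x (c ∷ []) 0F)))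
        (subst₂ _≡_ (lookup-++ˡ x (c ∷ []) i) (lookup-++ʳ x (c ∷ []) 0F))

  definable-fix : {X : Pred (Vec Carrier (suc n)) 0ℓ} → Definable X →
                  ∀ c → Definable {n} (λ x → (c ∷ x) ∈ X)
  definable-fix {X = X} D c = definable-resp
    (λ x → mk⇔ (λ p → c , refl , p) (λ { (_ , refl , p) → p }))
    (definable-∃ (definable-∩ {Y = X} (definable-const 0F c) D))

  definable-∃* : ∀ k {X : Pred (Vec Carrier (k ℕ.+ n)) 0ℓ} → Definable X →
                 Definable {n} (λ x → ∃[ y ] ((y ++ x) ∈ X))
  definable-∃* zero        D = definable-resp
    (λ x → mk⇔ (λ { ([] , p) → p }) (λ p → [] , p)) D
  definable-∃* (suc k) {X} D = definable-resp
    (λ x → mk⇔ (λ { (u ∷ y , p) → y , u , p }) (λ (y , u , p) → u ∷ y , p))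
    (definable-∃* k (definable-∃ {X = X} D))

-- Definable completeness from o-minimality.

module OMinimality {L : Language} (S : OrderedRingSymbols L) (𝔐 : Structure L)
  (rcf  : OrderedRingReduct.IsRealClosedOrderedField S 𝔐)
  (omin : OrderedRingReduct.IsOMinimal S 𝔐)
  (em   : ExcludedMiddle 0ℓ)
  where

  open OrderedRingReduct S 𝔐
  open IsRealClosedOrderedField rcf using (isOrderedField; orderedField)
  open OrderedField orderedField using (isStrictTotalOrder; 0<1)
  open OrderedFieldProperties isOrderedField
  open HardyField S 𝔐 rcf omin using (Eventually; DefinableFunction; 𝒦; 0ᴷ)
  open OrderedRingSymbols S
  open DefinableSets 𝔐
  open DefinableSetsProperties 𝔐
  private
    module O = IsStrictTotalOrder isStrictTotalOrder
    module 𝒦 = OrderedField 𝒦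
    module 𝒦O = IsStrictTotalOrder 𝒦.isStrictTotalOrder

  -- Leastness is given by witnesses: they survive the passage from a cell to a union of cells, and
  -- `cut-exists` needs a point of the complement above a given `r`.
  IsStrictSupremum : Pred Carrier 0ℓ → Carrier → Set
  IsStrictSupremum P h = (∀ x → P x → ¬ (h < x)) × (∀ u → u < h → ∃[ x ] (P x × u < x))

  private
    module E = ExtremaStrict _<_

    EmptyOrSup : Pred Carrier 0ℓ → Set
    EmptyOrSup P = (∀ x → ¬ P x) ⊎ ∃[ h ] IsStrictSupremum P h

    -- The upper endpoint is the supremum. The known point `w` ensures that whatever lies between
    -- `w` and the endpoint is also above `l`; an infinite endpoint would contradict the bound `b`.
    interval-sup : ∀ l u {b w} → w ∈ᶜ interval l u →
                   (∀ x → x ∈ᶜ interval l u → ¬ (b < x)) →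
                   ∃[ h ] IsStrictSupremum (_∈ᶜ interval l u) h
    interval-sup l ⊤± {b} {w} (l<w , _) bd =
      let (z , b<z , w<z) = unbounded₂ b w in
      ⊥-elim (bd z (E.<±-trans O.trans l<w E.[ w<z ] , E.[ z ]<⊤±) b<z)
    interval-sup l ⊥± (_ , SupremumStrict.[ () ]) bd
    interval-sup l [ u ] (l<w , w<u) bd = u
      , (λ x (_ , x<u) u<x → O.asym u<x (E.[<]-injective x<u))
      , λ v v<u → let (z , w<z , v<z , z<u) = above₂ (E.[<]-injective w<u) v<u in
          z , (E.<±-trans O.trans l<w E.[ w<z ] , E.[ z<u ]) , v<z

    cell-sup : ∀ C {b} → (∀ x → x ∈ᶜ C → ¬ (b < x)) → EmptyOrSup (_∈ᶜ C)
    cell-sup (point p) bd = inj₂ (p , (λ { _ refl → <-irrefl }) , λ u u<p → p , refl , u<p)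
    cell-sup (interval l u) bd with em {∃[ w ] (w ∈ᶜ interval l u)}
    ... | yes (w , w∈) = inj₂ (interval-sup l u w∈ bd)
    ... | no ∄w        = inj₁ λ w w∈ → ∄w (w , w∈)

    cells-sup : ∀ Cs {b} → (∀ x → Any (x ∈ᶜ_) Cs → ¬ (b < x)) → EmptyOrSup (λ x → Any (x ∈ᶜ_) Cs)
    cells-sup [] bd = inj₁ λ _ ()
    cells-sup (C ∷ Cs) bd
      with cell-sup C (λ x → bd x ∘ here) | cells-sup Cs (λ x → bd x ∘ there)
    ... | inj₁ ∅ | inj₁ ∅′ = inj₁ λ { x (here p) → ∅ x p ; x (there p) → ∅′ x p }
    ... | inj₂ (h , ub , lub) | inj₁ ∅′ = inj₂ (h
      , (λ { x (here p) → ub x p ; x (there p) → ⊥-elim (∅′ x p) })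
      , λ u u<h → let (x , p , q) = lub u u<h in x , here p , q)
    ... | inj₁ ∅ | inj₂ (h , ub , lub) = inj₂ (h
      , (λ { x (here p) → ⊥-elim (∅ x p) ; x (there p) → ub x p })
      , λ u u<h → let (x , p , q) = lub u u<h in x , there p , q)
    ... | inj₂ (h , ub , lub) | inj₂ (h′ , ub′ , lub′) with em {h < h′}
    ...   | yes h<h′ = inj₂ (h′
      , (λ { x (here p) h′<x → ub x p (O.trans h<h′ h′<x) ; x (there p) → ub′ x p })
      , λ u u<h′ → let (x , p , q) = lub′ u u<h′ in x , there p , q)
    ...   | no h≮h′ = inj₂ (h
      , (λ { x (here p) → ub x p
           ; x (there p) h<x → ub′ x p (≤-<-trans (≮⇒≥ h≮h′) h<x) })
      , λ u u<h → let (x , p , q) = lub u u<h in x , here p , q)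

  -- The infimum of a final segment `P`. Whether `h` itself belongs to `P` is left open, since an
  -- infimum of strict bounds need not be one of them.
  IsCut : Pred Carrier 0ℓ → Carrier → Set
  IsCut P h = (∀ r → h < r → P r) × (∀ r → P r → ¬ (r < h))

  UpClosed : Pred Carrier 0ℓ → Set
  UpClosed P = ∀ {r r′} → r < r′ → P r → P r′

  cut-unique : ∀ {P h h′} → IsCut P h → IsCut P h′ → h ≡ h′
  cut-unique {P} c c′ = ≮-antisym (not-below {P} c c′) (not-below {P} c′ c)
    where
    not-below : ∀ {P h h′} → IsCut P h → IsCut P h′ → ¬ (h < h′)
    -- A point strictly between the two values lies in `P` by the smaller cut and outside `P` by the
    -- larger.
    not-below (p , _) (_ , q) h<h′ = let (r , h<r , r<h′) = <-dense h<h′ in q r (p r h<r) r<h′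

  cut-cong : ∀ {P Q h} → (∀ r → P r → Q r) → (∀ r → Q r → P r) → IsCut P h → IsCut Q h
  cut-cong f g (p , q) = (λ r h<r → f r (p r h<r)) , λ r → q r ∘ g r

  -- The cut of P is the supremum of the complement of P.
  cut-exists : {P : Pred Carrier 0ℓ} → Definable {1} (λ ρ → P (lookup ρ 0F)) →
               UpClosed P → ∃[ r ] P r → ∃[ l ] (∀ r → P r → l < r) → ∃[ h ] IsCut P h
  cut-exists {P} D up (r₀ , Pr₀) (l , l<P) with omin _ (definable-¬ D)
  ... | Cs , e with cells-sup Cs {r₀} (λ x x∈ r₀<x → from (e x) x∈ (up r₀<x Pr₀))
  ...   | inj₁ ∅ = ⊥-elim (∅ l (to (e l) (λ Pl → <-irrefl (l<P l Pl))))
  ...   | inj₂ (h , ub , lub) = h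
    , (λ r h<r → decidable-stable em (λ ¬Pr → ub r (to (e r) ¬Pr) h<r))
    , λ r Pr r<h → let (x , x∈ , r<x) = lub r r<h in from (e x) x∈ (up r<x Pr)

  -- Germs at zero and the order of the Hardy field.

  eventually-∩ : {P Q : Pred Carrier 0ℓ} → Eventually P → Eventually Q → Eventually (P ∩ Q)
  eventually-∩ (c , 0<c , p) (d , 0<d , q) =
    let (m , 0<m , m<c , m<d) = below₂ 0<c 0<d in
    m , 0<m , λ t 0<t t<m → p t 0<t (O.trans t<m m<c) , q t 0<t (O.trans t<m m<d)

  eventually-map : {P Q : Pred Carrier 0ℓ} → (∀ {t} → 0# < t → P t → Q t) →
                   Eventually P → Eventually Q
  eventually-map f (c , 0<c , p) = c , 0<c , λ t 0<t t<c → f 0<t (p t 0<t t<c)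

  eventually-∃ : {P : Pred Carrier 0ℓ} → Eventually P → ∃[ t ] (0# < t × P t)
  eventually-∃ (c , 0<c , p) = let (t , 0<t , t<c) = <-dense 0<c in t , 0<t , p t 0<t t<c

  -- In the Hardy field `≤` asks that one of `<` and equality hold throughout an interval, whereas
  -- pointwise the two might alternate. Trichotomy of germs rules this out.
  eventually-≮⇒≤ᴷ : ∀ f g →
    Eventually (λ t → ¬ (DefinableFunction.fun g t < DefinableFunction.fun f t)) → f 𝒦.≤ g
  eventually-≮⇒≤ᴷ f g g≮f with 𝒦O.compare f g
  ... | tri< f<g _ _ = inj₁ f<g
  ... | tri≈ _ f≈g _ = inj₂ f≈g
  ... | tri> _ _ g<f =
    let (_ , _ , p , q) = eventually-∃ (eventually-∩ g≮f g<f) in ⊥-elim (p q)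

  definable-< : ∀ {n} (s t : Term L n) → Definable (λ ρ → ⟦ s ⟧ ρ < ⟦ t ⟧ ρ)
  definable-< s t = definable-rel lessˢ (s ∷ t ∷ [])

  eventually-zero? : ∀ f → Eventually (λ t → DefinableFunction.fun f t ≡ 0#) ⊎
                           Eventually (λ t → DefinableFunction.fun f t ≢ 0#)
  eventually-zero? f with 𝒦O.compare f 0ᴷ
  ... | tri< f<0 _ _ = inj₂ (eventually-map (λ _ l e → O.irrefl e l) f<0)
  ... | tri≈ _ f≈0 _ = inj₁ f≈0
  ... | tri> _ _ 0<f = inj₂ (eventually-map (λ _ l e → O.irrefl (sym e) l) 0<f)

  -- Definable functions from definable functional relations.

  module _ (G : Carrier → Carrier → Set)
           (D : Definable {2} (λ ρ → G (lookup ρ 0F) (lookup ρ 1F)))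
           (unique : ∀ {t y y′} → G t y → G t y′ → y ≡ y′)
           (total : ∀ t → 0# < t → ∃[ y ] G t y) where

    private
      value : ∀ t → Dec (0# < t) → Carrier
      value t (yes 0<t) = proj₁ (total t 0<t)
      -- A `DefinableFunction` is total, so it needs a value where `total` gives none; the choice
      -- does not affect the germ at zero.
      value t (no _)    = 0#

      value-spec : ∀ t (d : Dec (0# < t)) y →
        (value t d ≡ y) ⇔ ((0# < t × G t y) ⊎ (¬ (0# < t) × y ≡ 0#))
      value-spec t (yes 0<t) y = mk⇔
        (λ { refl → inj₁ (0<t , proj₂ (total t 0<t)) })
        (λ { (inj₁ (_ , g)) → unique (proj₂ (total t 0<t)) g
           ; (inj₂ (0≮t , _)) → ⊥-elim (0≮t 0<t) })
      value-spec t (no 0≮t) y = mk⇔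
        (λ { refl → inj₂ (0≮t , refl) })
        (λ { (inj₁ (0<t , _)) → ⊥-elim (0≮t 0<t)
           ; (inj₂ (_ , y≡0)) → sym y≡0 })

      0<t : Definable {2} (λ ρ → 0# < lookup ρ 0F)
      0<t = definable-< (app zeroˢ []) (var 0F)

    -- Since values are unique, the graph over positive `t` is `G` itself, so picking values outside
    -- the language keeps the function definable.
    definable-choice : ∃[ f ] (∀ t → 0# < t → G t (DefinableFunction.fun f t))
    definable-choice = record
      { fun       = λ t → value t em
      ; definable = definable-resp (λ { (t ∷ y ∷ []) → value-spec t em y })
          (definable-∪ (definable-∩ 0<t D)
            (definable-∩ (definable-¬ 0<t) (definable-≐ (var 1F) (app zeroˢ []))))
      } , λ t 0<t → spec t 0<t em
      where
      spec : ∀ t → 0# < t → (d : Dec (0# < t)) → G t (value t d)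
      spec t _   (yes 0<t) = proj₂ (total t 0<t)
      spec t 0<t (no 0≮t)  = ⊥-elim (0≮t 0<t)

  -- Trichotomy in 𝒦 decides the germ of an indicator function.
  eventually-decided : {P : Pred Carrier 0ℓ} → Definable {1} (λ ρ → P (lookup ρ 0F)) →
                       Eventually P ⊎ Eventually (λ t → ¬ P t)
  eventually-decided {P} D = decided (definable-choice Indicator
      (definable-∪ (definable-∩ D₂ (definable-≐ (var 1F) (app oneˢ [])))
                   (definable-∩ (definable-¬ D₂) (definable-≐ (var 1F) (app zeroˢ []))))
      (λ { (inj₁ (_ , refl)) (inj₁ (_ , refl)) → refl
         ; (inj₁ (p , _)) (inj₂ (¬p , _)) → ⊥-elim (¬p p)
         ; (inj₂ (¬p , _)) (inj₁ (p , _)) → ⊥-elim (¬p p)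
         ; (inj₂ (_ , refl)) (inj₂ (_ , refl)) → refl })
      (λ t _ → total t em))
    where
    Indicator : Carrier → Carrier → Set
    Indicator t y = (P t × y ≡ 1#) ⊎ (¬ P t × y ≡ 0#)
    D₂ : Definable {2} (λ ρ → P (lookup ρ 0F))
    D₂ = definable-reindex (λ { 0F → 0F }) D
    total : ∀ t → Dec (P t) → ∃[ y ] Indicator t y
    total t (yes p) = 1# , inj₁ (p , refl)
    total t (no ¬p) = 0# , inj₂ (¬p , refl)
    nonzero : ∀ {t y} → Indicator t y → y ≢ 0# → P t
    nonzero (inj₁ (p , _)) _   = p
    nonzero (inj₂ (_ , e)) y≢0 = ⊥-elim (y≢0 e)
    zero-out : ∀ {t y} → Indicator t y → y ≡ 0# → ¬ P t
    zero-out (inj₁ (_ , e′)) e = ⊥-elim (O.irrefl (trans (sym e) e′) 0<1)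
    zero-out (inj₂ (¬p , _)) _ = ¬p
    decided : ∃[ f ] (∀ t → 0# < t → Indicator t (DefinableFunction.fun f t)) →
              Eventually P ⊎ Eventually (λ t → ¬ P t)
    decided (χ , spec) with eventually-zero? χ
    ... | inj₁ χ≈0 = inj₂ (eventually-map (λ 0<t → zero-out (spec _ 0<t)) χ≈0)
    ... | inj₂ χ≉0 = inj₁ (eventually-map (λ 0<t → nonzero (spec _ 0<t)) χ≉0)

-- The sup metric in coordinates and definability of closeness.

module CurveDefinability {L : Language} (S : OrderedRingSymbols L) (𝔐 : Structure L)
  (rcf  : OrderedRingReduct.IsRealClosedOrderedField S 𝔐)
  (omin : OrderedRingReduct.IsOMinimal S 𝔐)
  (em   : ExcludedMiddle 0ℓ)
  where

  open OrderedRingReduct S 𝔐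
  open IsRealClosedOrderedField rcf using (isOrderedField; orderedField)
  open OrderedField orderedField using (isCommutativeRing; isStrictTotalOrder)
  open OrderedFieldProperties isOrderedField
  open OrderedRingSymbols S
  open DefinableSets 𝔐
  open DefinableSetsProperties 𝔐
  open OMinimality S 𝔐 rcf omin em
  open CurveGerms S 𝔐 rcf omin
  private
    module R = IsCommutativeRing isCommutativeRing
    module O = IsStrictTotalOrder isStrictTotalOrder
    variable
      k : ℕ

  Close : Carrier → Rel Carrier 0ℓ
  Close r u v = u < r + v × v < r + u

  -- The fold defining `dist` starts at `0#`, whence the positivity clause; it is all that remains
  -- when `k` is zero. The metric laws below are checked coordinatewise through this equivalence.
  dist<-⇔ : ∀ (x y : Vec Carrier k) r →
            (dist x y < r) ⇔ (0# < r × (∀ i → Close r (lookup x i) (lookup y i)))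
  dist<-⇔ [] [] r = mk⇔ (λ p → p , λ ()) proj₁
  dist<-⇔ (u ∷ x) (v ∷ y) r = mk⇔
    (λ p → let (p₀ , p₁) = to (⊔-<-⇔ _ _ r) p ; (0<r , q) = to (dist<-⇔ x y r) p₁ in
      0<r , λ { zero → to (∣x-y∣<-⇔ u v r) p₀ ; (suc i) → q i })
    (λ (0<r , q) → from (⊔-<-⇔ _ _ r)
      (from (∣x-y∣<-⇔ u v r) (q zero) , from (dist<-⇔ x y r) (0<r , q ∘ suc)))

  dist<⇒pos : ∀ (x y : Vec Carrier k) {r} → dist x y < r → 0# < r
  dist<⇒pos x y p = proj₁ (to (dist<-⇔ x y _) p)

  dist<-refl : ∀ (x : Vec Carrier k) {r} → 0# < r → dist x x < r
  dist<-refl x {r} 0<r = from (dist<-⇔ x x r) (0<r , λ i → close , close)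
    where
    close : ∀ {u} → u < r + u
    close {u} = subst (u <_) (R.+-comm u r) (x<x+y u 0<r)

  dist<-sym : ∀ (x y : Vec Carrier k) {r} → dist x y < r → dist y x < r
  dist<-sym x y p = let (0<r , q) = to (dist<-⇔ x y _) p in
    from (dist<-⇔ y x _) (0<r , λ i → proj₂ (q i) , proj₁ (q i))

  dist<-trans : ∀ (x y z : Vec Carrier k) {r s} → dist x y < r → dist y z < s → dist x z < r + s
  dist<-trans x y z {r} {s} p q =
    let (0<r , p′) = to (dist<-⇔ x y r) p ; (0<s , q′) = to (dist<-⇔ y z s) q in
    from (dist<-⇔ x z (r + s)) (+-pos 0<r 0<s , λ i →
        O.trans (proj₁ (p′ i)) (subst (r + lookup y i <_) (sym (R.+-assoc r s (lookup z i))) (+-monoʳ-< r (proj₁ (q′ i))))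
      , O.trans (proj₂ (q′ i)) (subst (s + lookup y i <_)
          (trans (sym (R.+-assoc s r (lookup x i))) (cong (_+ lookup x i) (R.+-comm s r)))
          (+-monoʳ-< s (proj₂ (p′ i)))))

  dist-separated : ∀ {x y : Vec Carrier k} → (∀ r → 0# < r → dist x y < r) → x ≡ y
  dist-separated {x = x} {y} p = trans (sym (tabulate∘lookup x))
    -- If two coordinates differed, taking their difference as `r` would make the larger one smaller
    -- than itself.
    (trans (tabulate-cong λ i → ≮-antisym (λ l → <-irrefl (step (proj₂ (close i _ (x<y⇒0<y-x l)))))
                                          (λ l → <-irrefl (step (proj₁ (close i _ (x<y⇒0<y-x l))))))
      (tabulate∘lookup y))
    where
    close : ∀ i r → 0# < r → Close r (lookup x i) (lookup y i)
    close i r 0<r = proj₂ (to (dist<-⇔ x y r) (p r 0<r)) i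
    step : ∀ {u v} → v < (v + - u) + u → v < v
    step {u} {v} = subst (v <_) (trans (R.+-comm _ u) (x+[y-x]≡y u v))

  distinct⇒far : ∀ {x y : Vec Carrier k} → x ≢ y → ∃[ r ] (0# < r × ¬ (dist x y < r))
  distinct⇒far {x = x} {y} x≢y with em {∃[ r ] (0# < r × ¬ (dist x y < r))}
  ... | yes far = far
  ... | no ¬far = ⊥-elim (x≢y (dist-separated λ r 0<r →
                    decidable-stable em λ d≮r → ¬far (r , 0<r , d≮r)))

  -- Stated for arbitrary maps rather than curves, so that it applies to constant maps, whose value
  -- need not be `a`.
  Im : (Carrier → Vec Carrier k) → Pred (Vec Carrier k) 0ℓ
  Im F x = ∃[ t ] (InUnitInterval t × F t ≡ x)

  -- Inclusion of `X` in the open `r`-neighbourhood of `Y`; the cut of these `r` is the one-sided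
  -- Hausdorff excess.
  Near : (X Y : Pred (Vec Carrier k) 0ℓ) → Carrier → Set
  Near X Y r = ∀ x → x ∈ X → ∃[ y ] (y ∈ Y × dist x y < r)

  HasDefinableCoordinates : (Carrier → Vec Carrier k) → Set
  HasDefinableCoordinates F = ∀ i → Definable {2}
    (λ ρ → InUnitInterval (lookup ρ 0F) × lookup (F (lookup ρ 0F)) i ≡ lookup ρ 1F)

  definable-unit : ∀ {n} (i : Fin n) → Definable (λ ρ → InUnitInterval (lookup ρ i))
  definable-unit i = definable-∩ (definable-< (app zeroˢ []) (var i)) (definable-< (var i) (app oneˢ []))

  const-coordinates : (x : Vec Carrier k) → HasDefinableCoordinates (λ _ → x)
  const-coordinates x i = definable-resp
    (λ ρ → mk⇔ (λ (u , e) → u , sym e) (λ (u , e) → u , sym e))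
    (definable-∩ (definable-unit 0F) (definable-const 1F (lookup x i)))

  curve-coordinates : {a : Vec Carrier k} (γ : Curve a) → HasDefinableCoordinates (Curve.fun γ)
  curve-coordinates {k} γ i = definable-resp
    (λ { ρ@(t ∷ u ∷ []) → mk⇔
      (λ (I , e) → fun t , subst (CurveGraph fun) (sym (reindexed ρ (fun t))) (I , refl)
                 , trans (lookup-++ˡ (fun t) ρ i) (trans e (sym (lookup-++ʳ (fun t) ρ 1F))))
      (λ (y , g , e) → let (I , fun≡y) = subst (CurveGraph fun) (reindexed ρ y) g in
        I , trans (cong (λ z → lookup z i) fun≡y)
              (trans (sym (lookup-++ˡ y ρ i)) (trans e (lookup-++ʳ y ρ 1F)))) })
    (definable-∃* k (definable-∩ (definable-reindex r definable)
                                 (definable-≐ (var (i ↑ˡ 2)) (var (k ↑ʳ 1F)))))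
    where
    open Curve γ using (fun; definable)
    -- The `k` quantified coordinates come first in the context, so the time and the coordinate
    -- value sit behind them.
    r : Fin (suc k) → Fin (k ℕ.+ 2)
    r zero    = k ↑ʳ 0F
    r (suc j) = j ↑ˡ 2
    reindexed : ∀ (ρ : Vec Carrier 2) y → tabulate (lookup (y ++ ρ) ∘ r) ≡ lookup ρ 0F ∷ y
    reindexed ρ y = cong₂ _∷_ (lookup-++ʳ y ρ 0F)
      (trans (tabulate-cong (lookup-++ˡ y ρ)) (tabulate∘lookup y))

  -- The unit-interval conditions belong to the set because the coordinate graphs are given as
  -- definable only over the unit interval.
  definable-dist : ∀ (F G : Carrier → Vec Carrier k) →
    HasDefinableCoordinates F → HasDefinableCoordinates G →
    Definable {3} (λ ρ → (InUnitInterval (lookup ρ 0F) × InUnitInterval (lookup ρ 1F)) ×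
                         dist (F (lookup ρ 0F)) (G (lookup ρ 1F)) < lookup ρ 2F)
  definable-dist F G DF DG = definable-resp
    (λ ρ → mk⇔
      (λ ((u , v) , p) → let (0<r , q) = to (dist<-⇔ (F (lookup ρ 0F)) (G (lookup ρ 1F)) (lookup ρ 2F)) p in
        (u , v) , 0<r , λ i → _ , _ , ((u , refl) , (v , refl)) , q i)
      (λ ((u , v) , 0<r , q) → (u , v) , from (dist<-⇔ (F (lookup ρ 0F)) (G (lookup ρ 1F)) (lookup ρ 2F)) (0<r , λ i → close-coordinates (q i))))
    (definable-∩ (definable-∩ (definable-unit 0F) (definable-unit 1F))
      (definable-∩ (definable-< (app zeroˢ []) (var 2F))
        (definable-⋀ λ i → definable-∃ (definable-∃ (definable-∩
          -- Under the two quantifiers, index 0 is the coordinate of `G` and 1 that of `F`; the two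
          -- times are 2 and 3, the radius is 4.
          (definable-∩ (definable-reindex (λ { 0F → 2F ; 1F → 1F }) (DF i))
                       (definable-reindex (λ { 0F → 3F ; 1F → 0F }) (DG i)))
          (definable-∩ (definable-< (var 1F) (app plusˢ (var 4F ∷ var 0F ∷ [])))
                       (definable-< (var 0F) (app plusˢ (var 4F ∷ var 1F ∷ [])))))))))
    where
    close-coordinates : ∀ {A B : Set} {x y r} → 
      ∃[ u ] ∃[ v ] (((A × x ≡ u) × (B × y ≡ v)) × Close r u v) → Close r x y
    close-coordinates (_ , _ , ((_ , refl) , (_ , refl)) , c) = c

  -- Quantifiers over points of the images become quantifiers over their times, so that only scalars
  -- are bound.
  definable-near : (F G : Carrier → Vec Carrier k) (a : Vec Carrier k) →
    HasDefinableCoordinates F → HasDefinableCoordinates G →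
    Definable {2} (λ ρ → Near (Ball a (lookup ρ 0F) ∩ Im F) (Ball a (lookup ρ 0F) ∩ Im G) (lookup ρ 1F))
  definable-near F G a DF DG = definable-resp
    (λ ρ → mk⇔
      (λ p s ((u , _) , b) → reparam (p (F s) (b , s , u , refl)) u)
      (λ { p _ (b , s , u , refl) → unparam (p s ((u , u) , b)) }))
    (definable-∀ (definable-⇒ em
      -- Membership in the ball is a distance from the constant map at `a`, with the same variable
      -- used for both times.
      (definable-reindex (λ { 0F → 0F ; 1F → 0F ; 2F → 1F }) (definable-dist (λ _ → a) F (const-coordinates a) DF))
      (definable-∃ (definable-∩
        (definable-reindex (λ { 0F → 0F ; 1F → 0F ; 2F → 2F }) (definable-dist (λ _ → a) G (const-coordinates a) DG))
        (definable-reindex (λ { 0F → 1F ; 1F → 0F ; 2F → 3F }) (definable-dist F G DF DG))))))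
    where
    U = InUnitInterval
    reparam : ∀ {s t r} → ∃[ y ] (y ∈ Ball a t ∩ Im G × dist (F s) y < r) → U s →
      ∃[ s′ ] (((U s′ × U s′) × dist a (G s′) < t) × ((U s × U s′) × dist (F s) (G s′) < r))
    reparam (_ , (b , s′ , v , refl) , d) u = s′ , ((v , v) , b) , ((u , v) , d)
    unparam : ∀ {s t r} →
      ∃[ s′ ] (((U s′ × U s′) × dist a (G s′) < t) × ((U s × U s′) × dist (F s) (G s′) < r)) →
      ∃[ y ] (y ∈ Ball a t ∩ Im G × dist (F s) y < r)
    unparam (s′ , ((v , _) , b) , (_ , d)) = G s′ , (b , s′ , v , refl) , d

-- Hausdorff distances as cuts.

module HausdorffDistance {L : Language} (S : OrderedRingSymbols L) (𝔐 : Structure L)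
  (rcf  : OrderedRingReduct.IsRealClosedOrderedField S 𝔐)
  (omin : OrderedRingReduct.IsOMinimal S 𝔐)
  (em   : ExcludedMiddle 0ℓ)
  where

  open OrderedRingReduct S 𝔐
  open IsRealClosedOrderedField rcf using (isOrderedField; orderedField)
  open OrderedField orderedField using (isStrictTotalOrder; 0<1; _⊔_)
  open OrderedFieldProperties isOrderedField
  open DefinableSets 𝔐
  open DefinableSetsProperties 𝔐
  open HardyField S 𝔐 rcf omin using (DefinableFunction)
  open OMinimality S 𝔐 rcf omin em
  open CurveGerms S 𝔐 rcf omin
  open CurveDefinability S 𝔐 rcf omin em
  open DefinableFunction
  private
    module O = IsStrictTotalOrder isStrictTotalOrder
    variable
      k : ℕ
      X Y Z X′ Y′ : Pred (Vec Carrier k) 0ℓ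

  NearPoint : Vec Carrier k → Pred (Vec Carrier k) 0ℓ → Carrier → Set
  NearPoint x Y r = ∃[ y ] (y ∈ Y × dist x y < r)

  cut⇒point-set-distance : ∀ (x : Vec Carrier k) {h} →
    IsCut (NearPoint x Y) h → IsPointSetDistance x Y h
  cut⇒point-set-distance {Y = Y} x {h} (p , q) = lower , greatest
    where
    lower : ∀ r → ∃[ y ] (y ∈ Y × r ≡ dist x y) → _
    lower _ (y , y∈Y , refl) = ≮⇒≥ λ d<h →
      let (r , d<r , r<h) = <-dense d<h in q r (y , y∈Y , d<r) r<h
    greatest : ∀ l → _ → _
    greatest l lb = ≮⇒≥ λ h<l → let (y , y∈Y , d<l) = p l h<l in
      ≤⇒≯ (lb _ (y , y∈Y , refl)) d<l

  point-set-distance<⇒near : ∀ (x : Vec Carrier k) {h r} →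
    IsPointSetDistance x Y h → h < r → NearPoint x Y r
  point-set-distance<⇒near {Y = Y} x {r = r} (_ , greatest) h<r = decidable-stable em λ ¬near →
    ≤⇒≯ (greatest r λ { _ (y , y∈Y , refl) → ≮⇒≥ λ d<r → ¬near (y , y∈Y , d<r) }) h<r

  -- `IsExcess` takes its supremum only over points possessing a distance to `Y`. This condition
  -- makes sure that no point of `X` is silently skipped.
  HaveDistancesTo : (X Y : Pred (Vec Carrier k) 0ℓ) → Set
  HaveDistancesTo X Y = ∀ x → x ∈ X → ∃[ h ] IsPointSetDistance x Y h

  cut⇒excess : HaveDistancesTo X Y → ∀ {s} → IsCut (Near X Y) s → IsExcess X Y s
  cut⇒excess {X = X} {Y} distances {s} (p , q) = upper , least
    where
    upper : ∀ r → ∃[ x ] (x ∈ X × IsPointSetDistance x Y r) → _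
    upper r (x , x∈X , lb , _) = ≮⇒≥ λ s<r → let (y , y∈Y , d<r) = p r s<r x x∈X in
      ≤⇒≯ (lb _ (y , y∈Y , refl)) d<r
    least : ∀ u → (∀ r → ∃[ x ] (x ∈ X × IsPointSetDistance x Y r) → _) → _
    least u ub = ≮⇒≥ λ u<s → let (r , u<r , r<s) = <-dense u<s in
      q r (λ x x∈X → let (h , H) = distances x x∈X in
             point-set-distance<⇒near x H (≤-<-trans (ub h (x , x∈X , H)) u<r)) r<s

  excess⇒cut : HaveDistancesTo X Y → ∀ {s} → IsExcess X Y s → IsCut (Near X Y) s
  excess⇒cut distances (upper , least) =
      (λ r s<r x x∈X → let (h , H) = distances x x∈X in
         point-set-distance<⇒near x H (≤-<-trans (upper h (x , x∈X , H)) s<r))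
    , λ r near → ≤⇒≯ (least r λ { ρ (x , x∈X , lb , _) → let (y , y∈Y , d<r) = near x x∈X in
                        inj₁ (≤-<-trans (lb _ (y , y∈Y , refl)) d<r) })

  NearBoth : (X Y : Pred (Vec Carrier k) 0ℓ) → Carrier → Set
  NearBoth X Y r = Near X Y r × Near Y X r

  -- The maximum of two cuts is the cut of the conjunction.
  hausdorff⇒cut : HaveDistancesTo X Y → HaveDistancesTo Y X → ∀ {h} →
                  IsHausdorffDistance X Y h → IsCut (NearBoth X Y) h
  hausdorff⇒cut D E (s , s′ , ex , ex′ , refl) =
    let (p , q) = excess⇒cut D ex ; (p′ , q′) = excess⇒cut E ex′ in
      (λ r h<r → let (s<r , s′<r) = to (⊔-<-⇔ s s′ r) h<r in p r s<r , p′ r s′<r)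
    , λ r (n , n′) r<h → ≤⇒≯ (⊔-≤ (≮⇒≥ (q r n)) (≮⇒≥ (q′ r n′))) r<h

  near-up : UpClosed (Near X Y)
  near-up r<r′ near x x∈X = let (y , y∈Y , d) = near x x∈X in y , y∈Y , O.trans d r<r′

  near-refl : ∀ {r} → 0# < r → Near X X r
  near-refl 0<r x x∈X = x , x∈X , dist<-refl x 0<r

  near-trans : ∀ {r s} → Near X Y r → Near Y Z s → Near X Z (r + s)
  near-trans p q x x∈X = let (y , y∈Y , d) = p x x∈X ; (z , z∈Z , e) = q y y∈Y in
    z , z∈Z , dist<-trans x y z d e

  near⇒pos : ∀ {r} → ∃[ x ] (x ∈ X) → Near X Y r → 0# < r
  near⇒pos (x , x∈X) near = let (y , _ , d) = near x x∈X in dist<⇒pos x y d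

  Accumulates : Vec Carrier k → Pred (Vec Carrier k) 0ℓ → Set
  Accumulates a X = ∀ η → 0# < η → NearPoint a X η

  -- Strict closeness does not notice the point `a`: as a new point of `X′` it is near `Y′` by
  -- accumulation, and as a lost witness from `Y` it is replaced by a point of `Y′` close to it.
  near-adjoin : ∀ {a : Vec Carrier k} {r} →
    (∀ x → x ∈ X′ → x ∈ X ∪ ｛ a ｝) → (∀ y → y ∈ Y → y ∈ Y′ ∪ ｛ a ｝) →
    ∃[ x ] (x ∈ X) → Accumulates a Y′ → Near X Y r → Near X′ Y′ r
  near-adjoin {Y′ = Y′} {a} {r} X′⊆X Y⊆Y′ nonempty acc near x x∈X′ with X′⊆X x x∈X′
  ... | inj₂ refl = acc r (near⇒pos nonempty near)
  ... | inj₁ x∈X with near x x∈X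
  ...   | y , y∈Y , d<r with Y⊆Y′ y y∈Y
  ...     | inj₁ y∈Y′ = y , y∈Y′ , d<r
  ...     | inj₂ refl =
    -- The slack between `q` and `r` pays for the move from `a` to `y′`.
    let (q , d<q , q<r)  = <-dense d<r
        (y′ , y′∈ , d<r-q) = acc _ (x<y⇒0<y-x q<r)
    in y′ , y′∈ , subst (dist x y′ <_) (x+[y-x]≡y q r) (dist<-trans x a y′ d<q d<r-q)

  -- If `p + q` were below `r`, density would leave room for some `s` above `p` and `t` above `q`
  -- with `s + t` still below `r`, where `R` fails.
  cut-triangle : ∀ {P Q R : Pred Carrier 0ℓ} {p q r} → (∀ {s t} → P s → Q t → R (s + t)) →
                 IsCut P p → IsCut Q q → IsCut R r → ¬ (p + q < r)
  cut-triangle {q = q} {r} add (P> , _) (Q> , _) (_ , R≥) p+q<r =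
    let (s , p<s , s<r-q) = <-dense (x+z<y⇒x<y-z p+q<r)
        (t , q<t , t<r-s) = <-dense (x+z<y⇒x<y-z (subst (_< r) (+-comm s q) (x<y-z⇒x+z<y s<r-q)))
    in R≥ (s + t) (add (P> s p<s) (Q> t q<t)) (subst (_< r) (+-comm t s) (x<y-z⇒x+z<y t<r-s))

  -- Traces of curves on balls around the limit.

  module _ {a : Vec Carrier k} where

    trace : Curve a → Carrier → Pred (Vec Carrier k) 0ℓ
    trace γ t = Ball a t ∩ Curve.Image γ

    trace-accumulates : ∀ γ {t} → 0# < t → Accumulates a (trace γ t)
    trace-accumulates γ {t} 0<t η 0<η =
      let (ε , 0<ε , ε<t , ε<η) = below₂ 0<t 0<η
          (δ , 0<δ , small)     = Curve.limit γ ε 0<ε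
          (s , 0<s , s<1 , s<δ) = below₂ 0<1 0<δ
          d                     = dist<-sym (Curve.fun γ s) a (small s (0<s , s<1) s<δ)
      in Curve.fun γ s , (O.trans d ε<t , s , (0<s , s<1) , refl) , O.trans d ε<η

    trace-nonempty : ∀ γ {t} → 0# < t → ∃[ x ] (x ∈ trace γ t)
    trace-nonempty γ 0<t = let (x , x∈ , _) = trace-accumulates γ 0<t _ 0<1 in x , x∈

    definable-near-curves : ∀ γ σ → Definable {2}
      (λ ρ → Near (trace γ (lookup ρ 0F)) (trace σ (lookup ρ 0F)) (lookup ρ 1F))
    definable-near-curves γ σ = definable-near (Curve.fun γ) (Curve.fun σ) a
      (curve-coordinates γ) (curve-coordinates σ)

    -- The point x is the trace of a constant curve, so near-definability applies to it.
    trace-distances : ∀ γ σ {t} → 0# < t → HaveDistancesTo (trace γ t) (trace σ t)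
    trace-distances γ σ {t} 0<t x (b , _) =
      let (h , cut) = cut-exists D (λ { r<r′ (y , y∈ , d) → y , y∈ , O.trans d r<r′ })
                        (let (y , y∈) = trace-nonempty σ 0<t in
                          dist x y + 1# , y , y∈ , x<x+y _ 0<1)
                        (0# , λ r (y , _ , d) → dist<⇒pos x y d)
      in h , cut⇒point-set-distance x cut
      where
      D : Definable {1} (λ ρ → NearPoint x (trace σ t) (lookup ρ 0F))
      D = definable-resp
        (λ ρ → mk⇔ (λ { p _ (_ , _ , _ , refl) → p })
                   (λ p → p x (b , proj₁ unit , proj₂ unit , refl)))
        (definable-fix {X = λ ρ → Near (Ball a (lookup ρ 0F) ∩ Im (λ _ → x)) (trace σ (lookup ρ 0F)) (lookup ρ 1F)}
          (definable-near (λ _ → x) (Curve.fun σ) a (const-coordinates x) (curve-coordinates σ)) t)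
        where
        unit : ∃[ s ] InUnitInterval s
        unit = <-dense 0<1

    near-cut-exists : ∀ γ σ {t} → 0# < t → ∃[ h ] IsCut (Near (trace γ t) (trace σ t)) h
    near-cut-exists γ σ {t} 0<t = cut-exists
      (definable-fix {X = λ ρ → Near (trace γ (lookup ρ 0F)) (trace σ (lookup ρ 0F)) (lookup ρ 1F)}
        (definable-near-curves γ σ) t)
      near-up
      -- Both traces lie in the ball of radius `t` around `a`, so any two of their points are less
      -- than `t + t` apart.
      (t + t , λ x (b , _) → let (y , y∈) = trace-nonempty σ 0<t in
        y , y∈ , dist<-trans x a y (dist<-sym a x b) (proj₁ y∈))
      (0# , λ r → near⇒pos (trace-nonempty γ 0<t))

    hausdorff-exists : ∀ γ σ {t} → 0# < t → ∃[ h ] IsHausdorffDistance (trace γ t) (trace σ t) h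
    hausdorff-exists γ σ 0<t =
      let (s , cut) = near-cut-exists γ σ 0<t ; (s′ , cut′) = near-cut-exists σ γ 0<t in
      s ⊔ s′ , s , s′ , cut⇒excess (trace-distances γ σ 0<t) cut
             , cut⇒excess (trace-distances σ γ 0<t) cut′ , refl

    -- The working form of the Hausdorff distance: definability and the metric laws are proved for
    -- this single cut, and `hausdorff⇔gap` translates back.
    Gap : Curve a → Curve a → Carrier → Carrier → Set
    Gap γ σ t = IsCut (NearBoth (trace γ t) (trace σ t))

    -- A gap does not exhibit the two one-sided excesses. They come from the Hausdorff distance
    -- already known to exist, which is a gap too and hence equals `h`.
    hausdorff⇔gap : ∀ γ σ {t h} → 0# < t →
                    IsHausdorffDistance (trace γ t) (trace σ t) h ⇔ Gap γ σ t h
    hausdorff⇔gap γ σ {t} {h} 0<t = mk⇔ gap λ g →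
      let (h′ , H) = hausdorff-exists γ σ 0<t in
      subst (IsHausdorffDistance (trace γ t) (trace σ t)) (cut-unique (gap H) g) H
      where
      gap : ∀ {h} → IsHausdorffDistance (trace γ t) (trace σ t) h → Gap γ σ t h
      gap = hausdorff⇒cut (trace-distances γ σ 0<t) (trace-distances σ γ 0<t)

    definable-gap : ∀ γ σ → Definable {2} (λ ρ → Gap γ σ (lookup ρ 0F) (lookup ρ 1F))
    definable-gap γ σ = definable-∩
      (definable-∀ (definable-⇒ em (definable-< (var 2F) (var 0F)) D))
      (definable-∀ (definable-⇒ em D (definable-¬ (definable-< (var 0F) (var 2F)))))
      where
      D : Definable {3} (λ ρ → NearBoth (trace γ (lookup ρ 1F)) (trace σ (lookup ρ 1F)) (lookup ρ 0F))
      D = definable-reindex (λ { 0F → 1F ; 1F → 0F })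
            (definable-∩ (definable-near-curves γ σ) (definable-near-curves σ γ))

    gap-function : ∀ γ σ → ∃[ f ] (∀ t → 0# < t → Gap γ σ t (fun f t))
    gap-function γ σ = definable-choice (Gap γ σ) (definable-gap γ σ) cut-unique
      λ t 0<t → let (h , H) = hausdorff-exists γ σ 0<t in h , to (hausdorff⇔gap γ σ 0<t) H

-- The closure of a curve near its limit.

module ClosureOfCurves {L : Language} (S : OrderedRingSymbols L) (𝔐 : Structure L)
  (rcf  : OrderedRingReduct.IsRealClosedOrderedField S 𝔐)
  (omin : OrderedRingReduct.IsOMinimal S 𝔐)
  (em   : ExcludedMiddle 0ℓ)
  where

  open OrderedRingReduct S 𝔐
  open IsRealClosedOrderedField rcf using (isOrderedField; orderedField)
  open OrderedField orderedField using (isStrictTotalOrder; 0<1)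
  open OrderedFieldProperties isOrderedField
  open OrderedRingSymbols S
  open HardyField S 𝔐 rcf omin using (Eventually)
  open DefinableSets 𝔐
  open DefinableSetsProperties 𝔐
  open OMinimality S 𝔐 rcf omin em
  open CurveGerms S 𝔐 rcf omin
  open CurveDefinability S 𝔐 rcf omin em
  private
    module O = IsStrictTotalOrder isStrictTotalOrder

  module _ {k} {a : Vec Carrier k} (γ : Curve a) where
    open Curve γ using (fun; continuous; limit; Image)

    -- The closure of the image.
    Adherent : Pred (Vec Carrier k) 0ℓ
    Adherent x = ∀ η → 0# < η → ∃[ s ] (InUnitInterval s × dist x (fun s) < η)

    private
      NearAt : Vec Carrier k → Carrier → Carrier → Set
      NearAt x s η = (InUnitInterval s × InUnitInterval s) × dist x (fun s) < η

      definable-near-at : ∀ x → Definable {2} (λ ρ → NearAt x (lookup ρ 0F) (lookup ρ 1F))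
      definable-near-at x = definable-reindex (λ { 0F → 0F ; 1F → 0F ; 2F → 1F })
        (definable-dist (λ _ → x) fun (const-coordinates x) (curve-coordinates γ))

    module _ (x : Vec Carrier k) (adherent : Adherent x)
             (x∉γ : ¬ (x ∈ Image)) (a≢x : a ≢ x) where

      -- Positive distance from `x` to the arc traversed before time `t`.
      AwayBefore : Carrier → Set
      AwayBefore t = ∃[ η ] (0# < η × (∀ s → InUnitInterval s → s < t → ¬ (dist x (fun s) < η)))

      definable-away : Definable {1} (λ ρ → AwayBefore (lookup ρ 0F))
      definable-away = definable-resp
        (λ ρ → mk⇔ (λ (η , 0<η , away) → η , 0<η , λ s ((u , _) , d) s<t → away s u s<t d)
                   (λ (η , 0<η , away) → η , 0<η , λ s u s<t d → away s ((u , u) , d) s<t))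
        (definable-∃ (definable-∩ (definable-< (app zeroˢ []) (var 0F))
          (definable-∀ (definable-⇒ em (definable-reindex (λ { 0F → 0F ; 1F → 1F }) (definable-near-at x))
            (definable-¬ (definable-< (var 0F) (var 2F)))))))

      -- Early points of the curve are within `h` of `a`; one within `h` of `x` as well would bring
      -- `x` closer to `a` than `η`.
      away-initially : ∃[ δ ] (0# < δ × AwayBefore δ)
      away-initially =
        let (η , 0<η , far)   = distinct⇒far (a≢x ∘ sym)
            (h , 0<h , h+h≡η) = halve 0<η
            (δ , 0<δ , small) = limit h 0<h
        in δ , 0<δ , h , 0<h , λ s u s<δ d →
             far (subst (dist x a <_) h+h≡η (dist<-trans x (fun s) a d (small s u s<δ)))

      -- Times before some `r` slightly below `t₀` are covered by the hypothesis, and those from `r`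
      -- to just past `t₀` by continuity, since the curve is not at `x` at time `t₀`.
      away-extend : ∀ {t₀} → InUnitInterval t₀ → (∀ r → r < t₀ → AwayBefore r) →
                    ∃[ r ] (t₀ < r × AwayBefore r)
      away-extend {t₀} u₀ away =
        let (η₀ , 0<η₀ , far)    = distinct⇒far (λ x≡γt₀ → x∉γ (t₀ , u₀ , sym x≡γt₀))
            (h , 0<h , h+h≡η₀)   = halve 0<η₀
            (δ , 0<δ , near)     = continuous t₀ u₀ h 0<h
            (r , t₀-δ<r , r<t₀)  = <-dense (x-y<x t₀ 0<δ)
            (r′ , t₀<r′ , r′<t₀+δ) = <-dense (x<x+y t₀ 0<δ)
            (ηᵣ , 0<ηᵣ , awayᵣ)  = away r r<t₀
            (η , 0<η , η<h , η<ηᵣ) = below₂ 0<h 0<ηᵣ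
        in r′ , t₀<r′ , η , 0<η , λ s u s<r′ d →
             let r≤s = ≮⇒≥ λ s<r → awayᵣ s u s<r (O.trans d η<ηᵣ)
                 s<δ+t₀ = subst (s <_) (+-comm t₀ δ) (O.trans s<r′ r′<t₀+δ)
                 t₀<δ+s = subst (t₀ <_) (+-comm s δ) (x-y<z⇒x<z+y (<-≤-trans t₀-δ<r r≤s))
                 γs-near-γt₀ = near s u (from (∣x-y∣<-⇔ s t₀ δ) (s<δ+t₀ , t₀<δ+s))
             in far (subst (dist x (fun t₀) <_) h+h≡η₀
                  (dist<-trans x (fun s) (fun t₀) (O.trans d η<h) γs-near-γt₀))

      -- Definable completeness stands in for compactness: the infimum `t₀` of the failing times
      -- would lie strictly between 0 and 1, and `away-extend` carries the property past it.
      away-everywhere : ∀ t → t < 1# → AwayBefore t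
      away-everywhere t t<1 = decidable-stable em λ ¬away →
        let (δ , 0<δ , awayδ) = away-initially
            (t₀ , above , below) = cut-exists (definable-¬ definable-away)
              (λ t<t′ ¬aₜ (η , 0<η , aw) → ¬aₜ (η , 0<η , λ s u s<t → aw s u (O.trans s<t t<t′)))
              (t , ¬away)
              (0# , λ r ¬aᵣ → <-≤-trans 0<δ (≮⇒≥ λ r<δ → ¬aᵣ (restrict r<δ awayδ)))
            0<t₀ = <-≤-trans 0<δ (≮⇒≥ λ t₀<δ → above δ t₀<δ awayδ)
            t₀<1 = ≤-<-trans (≮⇒≥ (below t ¬away)) t<1
            (r , t₀<r , awayᵣ) = away-extend (0<t₀ , t₀<1) λ r r<t₀ →
              decidable-stable em λ ¬aᵣ → below r ¬aᵣ r<t₀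
        in above r t₀<r awayᵣ
        where
        restrict : ∀ {r r′} → r < r′ → AwayBefore r′ → AwayBefore r
        restrict r<r′ (η , 0<η , aw) = η , 0<η , λ s u s<r → aw s u (O.trans s<r r<r′)

      -- Germs at 1⁻ are read off at 0⁺ after substituting 1 − u.
      close-to-end : ∀ η → 0# < η → Eventually (λ u → NearAt x (1# + - u) η)
      close-to-end η 0<η = near-end (eventually-decided D)
        where
        P : Carrier → Set
        P u = NearAt x (1# + - u) η
        E : Definable {1} (λ ρ → NearAt x (lookup ρ 0F) η)
        E = definable-fix {X = λ ρ → NearAt x (lookup ρ 1F) (lookup ρ 0F)}
              (definable-reindex (λ { 0F → 1F ; 1F → 0F }) (definable-near-at x)) η
        D : Definable {1} (λ ρ → P (lookup ρ 0F))
        D = definable-resp (λ ρ → mk⇔ (λ p → _ , refl , p) (λ { (_ , refl , p) → p }))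
          (definable-∃ (definable-∩
            (definable-≐ (var 0F) (app plusˢ (app oneˢ [] ∷ app negˢ (var 1F ∷ []) ∷ [])))
            (definable-reindex {n = 1} (λ { 0F → 0F }) E)))
        near-end : Eventually P ⊎ Eventually (λ u → ¬ P u) → Eventually P
        near-end (inj₁ p) = p
        -- If the curve stayed far from `x` near time 1, adherence would have to come from times
        -- before `t`, where the distance to `x` is at least `η′`.
        near-end (inj₂ (c , 0<c , far)) =
          let (t , 1-c<t , t<1)      = <-dense (x-y<x 1# 0<c)
              (η′ , 0<η′ , away)     = away-everywhere t t<1
              (ε , 0<ε , ε<η , ε<η′) = below₂ 0<η 0<η′
              (s , u@(_ , s<1) , d)  = adherent ε 0<ε
              t≤s = ≮⇒≥ λ s<t → away s u s<t (O.trans d ε<η′)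
              1<s+c = x-y<z⇒x<z+y (<-≤-trans 1-c<t t≤s)
          in ⊥-elim (far (1# + - s) (x<y⇒0<y-x s<1)
               (x<z+y⇒x-y<z (subst (1# <_) (+-comm s c) 1<s+c))
               (subst (λ w → NearAt x w η) (sym (x-[x-y]≡y 1# s)) ((u , u) , O.trans d ε<η)))

    closed-near-limit : ∃[ ε ] (0# < ε × (∀ x → x ∈ Ball a ε → Adherent x → x ∈ Image ∪ ｛ a ｝))
    closed-near-limit with em {∃[ x ] (Adherent x × ¬ (x ∈ Image ∪ ｛ a ｝))}
    ... | no ∄x = 1# , 0<1 , λ x _ adh → decidable-stable em λ x∉ → ∄x (x , adh , x∉)
    ... | yes (x₀ , adh₀ , x₀∉) =
      -- The radius is chosen so that the ball around `a` misses the exceptional point `x₀`.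
      let (ε , 0<ε , far) = distinct⇒far (x₀∉ ∘ inj₂) in
      ε , 0<ε , λ x b adh → decidable-stable em λ x∉ →
        -- Any other exceptional `x` would be within `h` of the same late point of the curve as
        -- `x₀`, so `x` and `x₀` would be less than `η` apart.
        let (η , 0<η , farₓ)    = distinct⇒far {x = x} {x₀} (λ { refl → far b })
            (h , 0<h , h+h≡η)   = halve 0<η
            (u , _ , (_ , d) , (_ , d₀)) = eventually-∃ (eventually-∩
              (close-to-end x adh (x∉ ∘ inj₁) (x∉ ∘ inj₂) h 0<h)
              (close-to-end x₀ adh₀ (x₀∉ ∘ inj₁) (x₀∉ ∘ inj₂) h 0<h))
        in farₓ (subst (dist x x₀ <_) h+h≡η
             (dist<-trans x _ x₀ d (dist<-sym x₀ (fun (1# + - u)) d₀)))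

-- Gaps and equality of germs.

module GermMetric {L : Language} (S : OrderedRingSymbols L) (𝔐 : Structure L)
  (rcf  : OrderedRingReduct.IsRealClosedOrderedField S 𝔐)
  (omin : OrderedRingReduct.IsOMinimal S 𝔐)
  (em   : ExcludedMiddle 0ℓ)
  where

  open OrderedRingReduct S 𝔐
  open IsRealClosedOrderedField rcf using (isOrderedField; orderedField)
  open OrderedField orderedField using (isStrictTotalOrder; 0<1)
  open OrderedFieldProperties isOrderedField
  open HardyField S 𝔐 rcf omin using (Eventually; DefinableFunction; 𝒦)
  open OMinimality S 𝔐 rcf omin em
  open CurveGerms S 𝔐 rcf omin
  open CurveDefinability S 𝔐 rcf omin em
  open HausdorffDistance S 𝔐 rcf omin em
  open ClosureOfCurves S 𝔐 rcf omin em
  open DefinableFunction using (fun)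
  private
    module O = IsStrictTotalOrder isStrictTotalOrder
    module 𝒦 = OrderedField 𝒦

  module _ {k} {a : Vec Carrier k} where

    trace-⊆ : ∀ {γ σ : Curve a} {ε t} →
      (∀ {x} → x ∈ Ball a ε ∩ (Curve.Image γ ∪ ｛ a ｝) → x ∈ Ball a ε ∩ (Curve.Image σ ∪ ｛ a ｝)) →
      t < ε → ∀ x → x ∈ trace γ t → x ∈ trace σ t ∪ ｛ a ｝
    trace-⊆ γ⊆σ t<ε x (b , x∈γ) with γ⊆σ (O.trans b t<ε , inj₁ x∈γ)
    ... | _ , inj₁ x∈σ = inj₁ (b , x∈σ)
    ... | _ , inj₂ a≡x = inj₂ a≡x

    -- Below both radii the traces change by at most the point `a`, which `near-adjoin` absorbs.
    -- Transporting every `h` lets this serve both congruence and vanishing on the diagonal.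
    gap-cong : ∀ {γ γ′ σ σ′ : Curve a} → γ ≈ᴳ γ′ → σ ≈ᴳ σ′ →
               Eventually (λ t → ∀ h → Gap γ σ t h → Gap γ′ σ′ t h)
    gap-cong {γ} {γ′} {σ} {σ′} (ε , 0<ε , γ⊆γ′ , γ′⊆γ) (η , 0<η , σ⊆σ′ , σ′⊆σ) =
      let (c , 0<c , c<ε , c<η) = below₂ 0<ε 0<η in
      c , 0<c , λ t 0<t t<c h →
        let t<ε = O.trans t<c c<ε ; t<η = O.trans t<c c<η
            γ→γ′ = trace-⊆ {γ} {γ′} γ⊆γ′ t<ε ; γ′→γ = trace-⊆ {γ′} {γ} γ′⊆γ t<ε
            σ→σ′ = trace-⊆ {σ} {σ′} σ⊆σ′ t<η ; σ′→σ = trace-⊆ {σ′} {σ} σ′⊆σ t<η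
        in cut-cong
          (λ r (n , n′) →
              near-adjoin γ′→γ σ→σ′ (trace-nonempty γ 0<t) (trace-accumulates σ′ 0<t) n
            , near-adjoin σ′→σ γ→γ′ (trace-nonempty σ 0<t) (trace-accumulates γ′ 0<t) n′)
          (λ r (n , n′) →
              near-adjoin γ→γ′ σ′→σ (trace-nonempty γ′ 0<t) (trace-accumulates σ 0<t) n
            , near-adjoin σ→σ′ γ′→γ (trace-nonempty σ′ 0<t) (trace-accumulates γ 0<t) n′)

    gap-nonneg : ∀ (γ σ : Curve a) {t h} → 0# < t → Gap γ σ t h → ¬ (h < 0#)
    gap-nonneg γ σ 0<t (near , _) h<0 =
      let (r , h<r , r<0) = <-dense h<0 in
      O.asym r<0 (near⇒pos (trace-nonempty γ 0<t) (proj₁ (near r h<r)))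

    gap-self : ∀ (γ : Curve a) {t h} → 0# < t → Gap γ γ t h → h ≡ 0#
    gap-self γ 0<t g@(_ , below) = ≮-antisym (gap-nonneg γ γ 0<t g) λ 0<h →
      let (r , 0<r , r<h) = <-dense 0<h in below r (near-refl 0<r , near-refl 0<r) r<h

    near-everywhere⇒⊆ : ∀ (γ σ : Curve a) {ε t} → (∀ x → x ∈ Ball a ε → Adherent σ x → x ∈ Curve.Image σ ∪ ｛ a ｝) →
      t < ε → (∀ r → 0# < r → Near (trace γ t) (trace σ t) r) →
      ∀ {x} → x ∈ Ball a t ∩ (Curve.Image γ ∪ ｛ a ｝) → x ∈ Ball a t ∩ (Curve.Image σ ∪ ｛ a ｝)
    near-everywhere⇒⊆ γ σ closed t<ε near (b , inj₂ a≡x) = b , inj₂ a≡x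
    near-everywhere⇒⊆ γ σ {t = t} closed t<ε near {x} (b , inj₁ x∈γ) =
      b , closed x (O.trans b t<ε) λ η 0<η → param (near η 0<η x (b , x∈γ))
      where
      param : ∀ {η} → NearPoint x (trace σ t) η →
              ∃[ s ] (InUnitInterval s × dist x (Curve.fun σ s) < η)
      param (_ , (_ , s , u , refl) , d) = s , u , d

    gap-zero⇒≈ᴳ : ∀ (γ σ : Curve a) → Eventually (λ t → Gap γ σ t 0#) → γ ≈ᴳ σ
    gap-zero⇒≈ᴳ γ σ (c , 0<c , gap) =
      let (ε , 0<ε , γ-closed)  = closed-near-limit γ
          (ε′ , 0<ε′ , σ-closed) = closed-near-limit σ
          (m , 0<m , m<ε , m<ε′) = below₂ 0<ε 0<ε′
          -- A single `t` suffices: gap zero there determines both traces on the whole ball, so `t`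
          -- itself is the radius of agreement.
          (t , 0<t , t<m , t<c)  = below₂ 0<m 0<c
          (near , _)             = gap t 0<t t<c
      in t , 0<t
         , near-everywhere⇒⊆ γ σ σ-closed (O.trans t<m m<ε′) (λ r 0<r → proj₁ (near r 0<r))
         , near-everywhere⇒⊆ σ γ γ-closed (O.trans t<m m<ε) (λ r 0<r → proj₂ (near r 0<r))

    gap-sym : ∀ (γ σ : Curve a) {t h} → Gap γ σ t h → Gap σ γ t h
    gap-sym γ σ = cut-cong (λ _ (n , n′) → n′ , n) (λ _ (n , n′) → n′ , n)

    gap-triangle : ∀ (γ σ τ : Curve a) {t p q r} → Gap γ σ t p → Gap σ τ t q → Gap γ τ t r → ¬ (p + q < r)
    gap-triangle γ σ τ {t} = cut-triangle λ {s} {s′} (m , m′) (n , n′) →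
      -- The way back passes through `σ` in the opposite order, hence the swapped sum.
      near-trans m n , subst (Near (trace τ t) (trace γ t)) (+-comm s′ s) (near-trans n′ m′)

  -- The metric axioms in the Hardy field.

  module _ {k} (a : Vec Carrier k) (d : Curve a → Curve a → DefinableFunction)
           (gap : ∀ γ σ t → 0# < t → Gap γ σ t (fun (d γ σ) t)) where

    isGermDistance : IsGermDistance a d
    isGermDistance γ σ f = mk⇔
      (eventually-map λ {t} 0<t e → from (hausdorff⇔gap γ σ 0<t)
        (subst (Gap γ σ t) (sym e) (gap γ σ t 0<t)))
      (eventually-map λ {t} 0<t H → cut-unique (to (hausdorff⇔gap γ σ 0<t) H) (gap γ σ t 0<t))

    private
      always : {P : Pred Carrier 0ℓ} → (∀ t → 0# < t → P t) → Eventually P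
      always p = 1# , 0<1 , λ t 0<t _ → p t 0<t

      d-cong : ∀ {γ γ′ σ σ′} → γ ≈ᴳ γ′ → σ ≈ᴳ σ′ → d γ σ 𝒦.≈ d γ′ σ′
      d-cong {γ} {γ′} {σ} {σ′} p q = eventually-map
        (λ {t} 0<t f → cut-unique (f _ (gap γ σ t 0<t)) (gap γ′ σ′ t 0<t))
        (gap-cong {γ = γ} {γ′} {σ} {σ′} p q)

      d-definite : ∀ {γ σ} → γ ≈ᴳ σ → d γ σ 𝒦.≈ 𝒦.0#
      d-definite {γ} {σ} p = eventually-map
        -- Replacing `γ` by `σ` in the first argument turns the gap into that of `σ` with itself.
        (λ {t} 0<t f → gap-self σ 0<t (f _ (gap γ σ t 0<t)))
        (gap-cong {γ = γ} {σ} {σ} {σ} p (≈ᴳ.refl {σ}))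
        where module ≈ᴳ = IsEquivalence (≈ᴳ-isEquivalence {a = a})

      d-indiscernible : ∀ {γ σ} → d γ σ 𝒦.≈ 𝒦.0# → γ ≈ᴳ σ
      d-indiscernible {γ} {σ} p = gap-zero⇒≈ᴳ γ σ
        (eventually-map (λ {t} 0<t e → subst (Gap γ σ t) e (gap γ σ t 0<t)) p)

    is𝒦-Metric : Is𝒦-Metric a d
    is𝒦-Metric = record
      { isSemiMetric = record
        { isQuasiSemiMetric = record
          { isPreMetric = record
            { isProtoMetric = record
              { isPartialOrder  = TotalOrder.isPartialOrder 𝒦.totalOrder
              ; ≈-isEquivalence = ≈ᴳ-isEquivalence
              ; cong            = λ {γ} {γ′} {σ} {σ′} → d-cong {γ} {γ′} {σ} {σ′}
              ; nonNegative     = λ {γ} {σ} → eventually-≮⇒≤ᴷ 𝒦.0# (d γ σ)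
                  (always λ t 0<t → gap-nonneg γ σ 0<t (gap γ σ t 0<t))
              }
            ; ≈⇒0 = λ {γ} {σ} → d-definite {γ} {σ}
            }
          ; 0⇒≈ = d-indiscernible
          }
        ; sym = λ γ σ → always λ t 0<t → cut-unique (gap γ σ t 0<t) (gap-sym σ γ (gap σ γ t 0<t))
        }
      ; triangle = λ γ σ τ → eventually-≮⇒≤ᴷ (d γ τ) (d γ σ 𝒦.+ d σ τ)
          (always λ t 0<t → gap-triangle γ σ τ (gap γ σ t 0<t) (gap σ τ t 0<t) (gap γ τ t 0<t))
      }

proposition6p2 : ExcludedMiddle 0ℓ →
    (L : Language) (S : OrderedRingSymbols L) (T : Theory L) →
    IsComplete T →
    (rcf : ExpandsRCF S T) (omin : IsOMinimalTheory S T) →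
    HasQuantifierElimination T →
    IsUniversallyAxiomatizable T →
    (𝔐 : Structure L) (𝔐⊨T : 𝔐 ⊨ᵀ T) (k : ℕ) (a : Vec (Structure.Carrier 𝔐) k) →
    let open CurveGerms S 𝔐 (rcf 𝔐 𝔐⊨T) (omin 𝔐 𝔐⊨T) in
    ∃[ d ] (IsGermDistance a d × Is𝒦-Metric a d)
proposition6p2 em L S T _ rcf omin _ _ 𝔐 𝔐⊨T k a = d , isGermDistance a d gap , is𝒦-Metric a d gap
  where
  open HausdorffDistance S 𝔐 (rcf 𝔐 𝔐⊨T) (omin 𝔐 𝔐⊨T) em using (gap-function)
  open GermMetric S 𝔐 (rcf 𝔐 𝔐⊨T) (omin 𝔐 𝔐⊨T) em using (isGermDistance; is𝒦-Metric)
  -- The representative has the right value at every positive `t`, not merely at small ones, so the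
  -- axioms can be checked pointwise.
  d   = λ γ σ → proj₁ (gap-function {a = a} γ σ)
  gap = λ γ σ → proj₂ (gap-function {a = a} γ σ)
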